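{- Let $d\ge 0$ be an integer and let $G$ be a $d$-regular graph that contains no $4$-cycle. If $\kappa(G)\leq\frac{d+1}{2}$, then $\varphi(G)=d+1$. This upper bound for the vertex connectivity is sharp for the Petersen graph, in the sense that the Petersen graph is $d$-regular with $d=3$, contains no $4$-cycle, has vertex connectivity $\frac{d+1}{2}+1=3$, and its b-chromatic number is not $d+1=4$.
   Context: All graphs are finite and simple (undirected, loopless, without multiple edges), with nonempty vertex set. "Contains no $4$-cycle" means that $G$ has no subgraph (not necessarily induced) isomorphic to the cycle $C_4$ of length $4$. The vertex connectivity $\kappa(G)$ is the minimum cardinality of a subset $U$ of $V(G)$ such that $G\setminus U$ is either disconnected or a graph with only one vertex (so $\kappa(G)=0$ if $G$ is disconnected). A b-coloring of a graph $G$ by $k$ colors is a proper vertex coloring with $k$ colors in which each of the $k$ color classes contains a vertex that is adjacent to at least one vertex in each of the other $k-1$ color classes. The b-chromatic number $\varphi(G)$ is the largest integer $k$ such that $G$ admits a b-coloring by $k$ colors. -}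

module Defs where

open import Data.Fin using (Fin; #_; _≟_)
open import Data.Fin.Subset using (Subset; ∣_∣; _∉_)
open import Data.List using (List; []; _∷_; length; filter; allFin)
open import Data.List.Membership.Propositional using (_∈_)
open import Data.List.Relation.Unary.All as All using (All)
open import Data.Nat using (ℕ; _≤_)
open import Data.Product using (∃-syntax; _×_; _,_; proj₁; uncurry)
open import Data.Product.Properties using (≡-dec)
open import Data.Sum using (_⊎_; [_,_]; swap)
open import Function.Definitions using (Injective)
open import Level using (0ℓ)
open import Relation.Binary using (Rel; Decidable; Symmetric; Irreflexive)
open import Relation.Binary.Construct.Closure.ReflexiveTransitive using (Star)
open import Relation.Binary.PropositionalEquality using (_≡_; _≢_; refl)
open import Relation.Nullary using (¬_; Dec)
open import Relation.Nullary.Decidable using (_⊎-dec_; True; toWitness; ¬?)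
import Data.List.Membership.DecPropositional as DecMembership

record Graph (V : Set) : Set₁ where
  field
    Adj    : Rel V 0ℓ
    adj?   : Decidable Adj
    symm   : Symmetric Adj
    irrefl : Irreflexive _≡_ Adj

open Graph public

degree : ∀ {n} → Graph (Fin n) → Fin n → ℕ
degree {n} G v = length (filter (adj? G v) (allFin n))

Regular : ∀ {n} → Graph (Fin n) → ℕ → Set
Regular G d = ∀ v → degree G v ≡ d

-- G has a (not necessarily induced) subgraph isomorphic to H.
Contains : ∀ {V W} → Graph V → Graph W → Set
Contains {V} {W} G H =
  ∃[ f ] Injective _≡_ _≡_ f × (∀ {u v : W} → Adj H u v → Adj G (f u) (f v))

Connected : ∀ {V} → Graph V → Set
Connected G = ∀ u v → Star (Adj G) u v

Disconnected : ∀ {V} → Graph V → Set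
Disconnected G = ¬ Connected G

OneVertex : ∀ {V} → Graph V → Set
OneVertex {V} _ = ∃[ v ] (∀ (w : V) → w ≡ v)

-- Any two proofs of v ∉ U are definitionally equal, because ⊥ is
-- proof-irrelevant; so each v outside U gives exactly one vertex of G ∖ U.
infixl 6 _∖_
_∖_ : ∀ {n} → Graph (Fin n) → (U : Subset n) → Graph (∃[ v ] v ∉ U)
(G ∖ U) .Adj  x y      = Adj G (proj₁ x) (proj₁ y)
(G ∖ U) .adj? x y      = adj? G (proj₁ x) (proj₁ y)
(G ∖ U) .symm          = symm G
(G ∖ U) .irrefl refl   = irrefl G refl

-- U may not be the whole vertex set: G ∖ U would then be vacuously Connected
-- and would not satisfy OneVertex.
Separating : ∀ {n} → Graph (Fin n) → Subset n → Set
Separating G U = Disconnected (G ∖ U) ⊎ OneVertex (G ∖ U)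

-- κ(G) = k
IsVertexConnectivity : ∀ {n} → Graph (Fin n) → ℕ → Set
IsVertexConnectivity G k =
  (∃[ U ] Separating G U × ∣ U ∣ ≡ k) × (∀ U → Separating G U → k ≤ ∣ U ∣)

Proper : ∀ {V k} → Graph V → (V → Fin k) → Set
Proper G c = ∀ {u v} → Adj G u v → c u ≢ c v

IsBColoring : ∀ {V k} → Graph V → (V → Fin k) → Set
IsBColoring G c =
  Proper G c ×
  (∀ i → ∃[ v ] c v ≡ i × (∀ j → j ≢ i → ∃[ u ] Adj G v u × c u ≡ j))

HasBColoring : ∀ {V} → Graph V → ℕ → Set
HasBColoring {V} G k = ∃[ c ] IsBColoring {V} {k} G c

-- φ(G) = k
IsBChromaticNumber : ∀ {V} → Graph V → ℕ → Set
IsBChromaticNumber G k =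
  HasBColoring G k × (∀ m → HasBColoring G m → m ≤ k)

module _ {n : ℕ} where
  open DecMembership (≡-dec (_≟_ {n}) (_≟_ {n})) using (_∈?_)

  Loopless : List (Fin n × Fin n) → Set
  Loopless = All (uncurry _≢_)

  loopless? : ∀ es → Dec (Loopless es)
  loopless? = All.all? (λ (x , y) → ¬? (x ≟ y))

  fromEdges : (es : List (Fin n × Fin n)) {_ : True (loopless? es)} →
              Graph (Fin n)
  fromEdges es     .Adj  x y    = (x , y) ∈ es ⊎ (y , x) ∈ es
  fromEdges es     .adj? x y    = ((x , y) ∈? es) ⊎-dec ((y , x) ∈? es)
  fromEdges es     .symm        = swap
  fromEdges es {t} .irrefl refl = [ noLoop , noLoop ]
    where
    noLoop : ∀ {x} → ¬ (x , x) ∈ es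
    noLoop x∈es = All.lookup (toWitness t) x∈es refl

C₄ : Graph (Fin 4)
C₄ = fromEdges
  ((# 0 , # 1) ∷ (# 1 , # 2) ∷ (# 2 , # 3) ∷ (# 3 , # 0) ∷ [])

-- Outer pentagon on 0–4, spokes i — i+5, inner pentagram on 5–9.
petersen : Graph (Fin 10)
petersen = fromEdges
  ( (# 0 , # 1) ∷ (# 1 , # 2) ∷ (# 2 , # 3) ∷ (# 3 , # 4) ∷ (# 4 , # 0)
  ∷ (# 0 , # 5) ∷ (# 1 , # 6) ∷ (# 2 , # 7) ∷ (# 3 , # 8) ∷ (# 4 , # 9)
  ∷ (# 5 , # 7) ∷ (# 7 , # 9) ∷ (# 9 , # 6) ∷ (# 6 , # 8) ∷ (# 8 , # 5)
  ∷ [])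

{-# OPTIONS --safe #-}
module Submission where

-- For d ≥ 2 let U be a minimum separating set and v a vertex on one side all of whose neighbours avoid U. (If every
-- vertex of the side had a neighbour in U, counting edges into U would force d = 2 and |U| = 1, contradicting
-- minimality, or d = 3 and |U| = 2, where following edges produces a 4-cycle or a vertex of degree 4.)
-- As two vertices have at most one common neighbour, at most |U| neighbours of v have a neighbour in U, so at least
-- r = ⌊d/2⌋ do not. Using d + 1 colours, prescribe distinct ones on v and r such neighbours and colour their closed neighbourhoods
-- injectively, one after the other. When N[w] is coloured, the neighbourhoods treated earlier each forbid at most one
-- colour per vertex and one vertex per colour, so starting from any injective colouring conflicts can be removed by
-- exchanging colours. The result makes r + 1 colours b-dominating and stays inside its side of U, so the same on the
-- other side yields the remaining colours without interference, and the rest is coloured greedily.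

open import Data.Empty using (⊥)
open import Data.Fin as Fin using (Fin; zero; suc; _≟_; cast; fromℕ<; inject≤; opposite; punchIn; punchOut; toℕ)
open import Data.Fin.Patterns using (0F; 1F; 2F; 3F; 4F; 5F; 6F; 7F; 8F; 9F)
open import Data.Fin.Permutation.Components using (transpose; transpose-inverse)
open import Data.Fin.Properties as Fin using (all?; any?; injective⇒≤; punchIn-punchOut; punchOut-injective)
open import Data.Fin.Subset as Subset using (Subset; inside; outside; ∣_∣; _-_)
open import Data.Fin.Subset.Properties using (_∈?_; anySubset?; x∈p∧x≢y⇒x∈p-y; x∈p⇒∣p-x∣<∣p∣; ∉⊥; ∣⊥∣≡0)
open import Data.List using (List; []; _∷_; _++_; allFin; filter; length; lookup; map; mapMaybe; take)
open import Data.List.Membership.Propositional using (_∈_; _∉_)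
open import Data.List.Membership.Propositional.Properties
  using (∈-++⁺ˡ; ∈-++⁺ʳ; ∈-++⁻; ∈-allFin; ∈-filter⁺; ∈-filter⁻; ∈-lookup; ∈-map⁺)
open import Data.List.Properties using (length-++; length-map; length-mapMaybe; length-tabulate; length-take)
open import Data.List.Relation.Unary.All as All using (All; []; _∷_)
import Data.List.Relation.Unary.All.Properties as All
open import Data.List.Relation.Unary.AllPairs using ([]; _∷_)
open import Data.List.Relation.Unary.Any as Any using (here; there; index)
open import Data.List.Relation.Unary.Any.Properties using (lookup-index; map⁺; mapMaybe⁺)
open import Data.List.Relation.Unary.Unique.Propositional using (Unique)
open import Data.List.Relation.Unary.Unique.Propositional.Properties using (++⁺; allFin⁺; filter⁺; take⁺)
open import Data.Maybe using (Maybe; just; nothing; _<∣>_)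
open import Data.Maybe.Properties using (just-injective; ≡-dec)
import Data.Maybe.Relation.Unary.Any as Maybe
open import Data.Nat as ℕ using (ℕ; NonZero; zero; suc; _+_; _*_; _≤_; _<_; z≤n; s≤s)
open import Data.Nat.DivMod using (_/_)
open import Data.Nat.Properties
  using (*-cancelˡ-<; *-distribˡ-+; *-monoʳ-≤; *-suc; +-cancelʳ-≤; +-cancelˡ-≤; +-comm; +-identityʳ; +-mono-≤;
         +-monoʳ-<; +-monoʳ-≤; +-monoˡ-≤; +-suc; 1+n≰n; <⇒≱; _≤?_; m≤m+n; m≤n+m; m≤n+o⇒m∸n≤o; m≤n⇒m⊓n≡m;
         n≤1+n; n≮n; ≤-antisym; ≤-refl; ≤-reflexive; ≤-trans; ≰⇒>; module ≤-Reasoning)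
open import Data.Nat.Solver using (module +-*-Solver)
open import Data.Product using (∃; ∃-syntax; _×_; _,_; proj₁; proj₂)
open import Data.Sum using (_⊎_; inj₁; inj₂; [_,_])
open import Data.Vec as Vec using (Vec; []; _∷_; tabulate)
open import Data.Vec.Properties using ([]=⇒lookup; lookup⇒[]=; lookup∘tabulate)
open import Function using (_∘_; const; id)
open import Function.Definitions using (Injective)
open import Relation.Binary.Construct.Closure.ReflexiveTransitive using (Star; ε; _◅_; _◅◅_)
open import Relation.Binary.PropositionalEquality
  using (_≡_; _≢_; refl; sym; trans; cong; cong₂; subst; module ≡-Reasoning)
open import Relation.Nullary using (¬_; Dec; yes; no; contradiction)
open import Relation.Nullary.Decidable
  using (True; ¬?; _×-dec_; _⊎-dec_; _→-dec_; ¬¬-excluded-middle; dec-true; decidable-stable; does; from-no; from-yes;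
         toWitness)
open import Relation.Unary using (Decidable)
open import Defs
open +-*-Solver using (solve; con; _:+_; _:*_; _:=_)

-- Finite injections and counting.

Inj : ∀ {A B : Set} → (A → B) → Set
Inj = Injective _≡_ _≡_

lookup-inj : ∀ {A : Set} {xs : List A} → Unique xs → Inj (lookup xs)
lookup-inj                (_ ∷ _)      {zero}  {zero}  _  = refl
lookup-inj {xs = x ∷ xs} (x∉ ∷ _)      {zero}  {suc j} eq = contradiction eq (All.lookup x∉ (∈-lookup j))
lookup-inj {xs = x ∷ xs} (x∉ ∷ _)      {suc i} {zero}  eq = contradiction (sym eq) (All.lookup x∉ (∈-lookup i))
lookup-inj                (_ ∷ xs!)    {suc i} {suc j} eq = cong suc (lookup-inj xs! eq)

length-map-allFin : ∀ {A : Set} {n} (f : Fin n → A) → length (map f (allFin n)) ≡ n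
length-map-allFin {n = n} f = trans (length-map f (allFin n)) (length-tabulate {n = n} id)

fresh : ∀ {N} (xs : List (Fin N)) → length xs < N → ∃[ k ] k ∉ xs
fresh {N} xs |xs|<N with any? (λ k → ¬? (Any.any? (k ≟_) xs))
... | yes found = found
... | no  none  = contradiction (injective⇒≤ index-inj) (<⇒≱ |xs|<N)
  where
  all∈ : ∀ k → k ∈ xs
  all∈ k = decidable-stable (Any.any? (k ≟_) xs) λ k∉ → none (k , k∉)

  index-inj : Inj (index ∘ all∈)
  index-inj {k} {l} eq = trans (lookup-index (all∈ k)) (trans (cong (lookup xs) eq) (sym (lookup-index (all∈ l))))

inj⇒surj : ∀ {N} {f : Fin N → Fin N} → Inj f → ∀ k → ∃[ p ] f p ≡ k
inj⇒surj {suc N} {f} inj k with any? (λ p → f p ≟ k)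
... | yes found = found
... | no  none  = contradiction (injective⇒≤ skip-inj) (n≮n N)
  where
  k≢f : ∀ p → k ≢ f p
  k≢f p eq = none (p , sym eq)

  skip-inj : Inj (λ p → punchOut (k≢f p))
  skip-inj {p} {q} eq = inj (punchOut-injective (k≢f p) (k≢f q) eq)

module _ {N : ℕ} (x y : Fin N) where

  transpose-inj : Inj (transpose x y)
  transpose-inj {p} {q} eq =
    trans (sym (transpose-inverse y x)) (trans (cong (transpose y x) eq) (transpose-inverse y x))

  transpose-cases : (P : Fin N → Fin N → Set) → P x y → P y x → (∀ {p} → p ≢ x → p ≢ y → P p p) →
    ∀ p → P p (transpose x y p)
  transpose-cases P Pxy Pyx P-other p with p ≟ x
  ... | yes refl = Pxy
  ... | no p≢x with p ≟ y
  ...   | yes refl = Pyx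
  ...   | no p≢y   = P-other p≢x p≢y

-- Distinct members of `xs` have distinct partners in `U`, because `S` determines its first
-- argument; so each partner can be deleted from `U` before the next one is sought. The later bounds
-- by `∣ U ∣` are instances.
length≤card : ∀ {A : Set} {n} (S : A → Fin n → Set) → (∀ {x x′ u} → S x u → S x′ u → x ≡ x′) →
  ∀ {xs} → Unique xs → (U : Subset n) → (∀ {x} → x ∈ xs → ∃[ u ] u Subset.∈ U × S x u) → length xs ≤ ∣ U ∣
length≤card S S-inj [] U hit = z≤n
length≤card S S-inj (x∉ ∷ xs!) U hit with hit (here refl)
... | u , u∈U , Sxu = ≤-trans (s≤s (length≤card S S-inj xs! (U - u) hit′)) (x∈p⇒∣p-x∣<∣p∣ u∈U)
  where
  hit′ : ∀ {y} → y ∈ _ → ∃[ w ] w Subset.∈ (U - u) × S y w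
  hit′ y∈ with hit (there y∈)
  ... | w , w∈U , Syw =
    w , x∈p∧x≢y⇒x∈p-y w∈U (λ { refl → All.lookup x∉ y∈ (S-inj Sxu Syw) }) , Syw

⊆⇒length≤card : ∀ {n} {xs} → Unique xs → (U : Subset n) → (∀ {x} → x ∈ xs → x Subset.∈ U) → length xs ≤ ∣ U ∣
⊆⇒length≤card xs! U xs⊆U = length≤card _≡_ (λ { refl refl → refl }) xs! U (λ {x} x∈ → x , xs⊆U x∈ , refl)

-- Completing partial injections to permutations.

module Completion {N : ℕ} (R : Fin N → Fin N → Set) (R? : ∀ p → Dec (∃ (R p)))
  (R-fun : ∀ {p k k′} → R p k → R p k′ → k ≡ k′)
  (R-inj : ∀ {p p′ k} → R p k → R p′ k → p ≡ p′) where

  -- Starting from the identity, the value `k` prescribed at `p` is fetched by exchanging `p` with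
  -- the position `q` that holds it. A prescription already met at `q` would also be `k`, so `R-inj`
  -- forces `p ≡ q` and nothing is spoiled.
  complete : ∃[ h ] Inj h × (∀ {p k} → R p k → h p ≡ k)
  complete = let h , h-inj , h-R = go (allFin N) in h , h-inj , h-R (∈-allFin _)
    where
    go : ∀ ps → ∃[ h ] Inj h × (∀ {p k} → p ∈ ps → R p k → h p ≡ k)
    go []       = id , id , λ ()
    go (p ∷ ps) with go ps | R? p
    ... | h , h-inj , h-R | no  ¬Rp = h , h-inj , λ where
      (here refl) Rpk → contradiction (_ , Rpk) ¬Rp
      (there p∈)  Rpk → h-R p∈ Rpk
    ... | h , h-inj , h-R | yes (k , Rpk) with inj⇒surj h-inj k
    ...   | q , hq≡k = h ∘ transpose p q , transpose-inj p q ∘ h-inj , ok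
      where
      ok : ∀ {r l} → r ∈ p ∷ ps → R r l → h (transpose p q r) ≡ l
      ok {r} {l} = transpose-cases p q (λ r r′ → r ∈ p ∷ ps → R r l → h r′ ≡ l)
        (λ _ Rpl → trans hq≡k (R-fun Rpk Rpl))
        at-q
        (λ { r≢p _ (here r≡p) _ → contradiction r≡p r≢p ; _ _ (there r∈) Rrl → h-R r∈ Rrl }) r
        where
        at-q : q ∈ p ∷ ps → R q l → h p ≡ l
        at-q (here refl) Rql = trans hq≡k (R-fun Rpk Rql)
        at-q (there q∈)  Rql =
          let l≡k = trans (sym (h-R q∈ Rql)) hq≡k
              p≡q = R-inj Rpk (subst (R q) l≡k Rql)
          in trans (cong h p≡q) (trans hq≡k (sym l≡k))

  -- A position x violating some B j is repaired by exchanging its value with that of a position y outside F.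
  -- Each B i excludes at most one y through the new value of x and one through that of y,
  -- and for i = j both of these are x itself, so fewer than N positions are excluded.
  module _ {t : ℕ} (B : Fin t → Fin N → Fin N → Set) (B? : ∀ j p k → Dec (B j p k))
    (B-fun : ∀ {j p k k′} → B j p k → B j p k′ → k ≡ k′)
    (B-inj : ∀ {j p p′ k} → B j p k → B j p′ k → p ≡ p′)
    (B-free : ∀ {j p k l} → B j p k → ¬ R p l)
    (F : List (Fin N)) (R⊆F : ∀ {p k} → R p k → p ∈ F) (room : length F + 2 * t ≤ N) where

    Safe : (Fin N → Fin N) → Fin N → Set
    Safe h p = ∀ j → ¬ B j p (h p)

    completeAvoiding : ∃[ h ] Inj h × (∀ {p k} → R p k → h p ≡ k) × (∀ p → Safe h p)
    completeAvoiding = let h , h-inj , h-R , safe = go (allFin N) in h , h-inj , h-R , λ p → safe (∈-allFin p)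
      where
      module Repair (h : Fin N → Fin N) (h-inj : Inj h) (x : Fin N) where
        rows : ∀ j → ∃[ y ] (∀ {z} → B j x (h z) → z ≡ y) × (∀ {z} → B j x (h z) → B j x (h y))
        rows j with any? (λ y → B? j x (h y))
        ... | yes (y , Bxy) = y , (λ Bxz → h-inj (B-fun Bxz Bxy)) , λ _ → Bxy
        -- With no clashing position, `x` is a mere filler and both claims are vacuous.
        ... | no  none      = x , (λ Bxz → contradiction (_ , Bxz) none) , λ Bxz → contradiction (_ , Bxz) none

        cols : ∀ j → ∃[ y ] (∀ {z} → B j z (h x) → z ≡ y)
        cols j with any? (λ y → B? j y (h x))
        ... | yes (y , Byx) = y , λ Bzx → B-inj Bzx Byx
        ... | no  none      = x , λ Bzx → contradiction (_ , Bzx) none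

      partner : ∀ h → Inj h → ∀ x j → B j x (h x) →
        ∃[ y ] y ∉ F × y ≢ x × (∀ i → ¬ B i x (h y)) × (∀ i → ¬ B i y (h x))
      partner h h-inj x j Bx = search t refl j Bx
        where
        open Repair h h-inj x
        search : ∀ s → t ≡ s → (j : Fin t) → B j x (h x) →
          ∃[ y ] y ∉ F × y ≢ x × (∀ i → ¬ B i x (h y)) × (∀ i → ¬ B i y (h x))
        search (suc s) refl j Bx with fresh excluded |excluded|<N
          where
          excluded = F ++ map (proj₁ ∘ rows) (allFin (suc s)) ++ map (proj₁ ∘ cols ∘ punchIn j) (allFin s)

          |excluded|<N : length excluded < N
          |excluded|<N = begin-strict
            length excluded
              ≡⟨ trans (length-++ F) (cong (length F +_) (length-++ (map (proj₁ ∘ rows) (allFin (suc s))))) ⟩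
            length F + (length (map (proj₁ ∘ rows) (allFin (suc s)))
              + length (map (proj₁ ∘ cols ∘ punchIn j) (allFin s)))
              ≡⟨ cong₂ (λ a b → length F + (a + b))
                   (length-map-allFin (proj₁ ∘ rows)) (length-map-allFin (proj₁ ∘ cols ∘ punchIn j)) ⟩
            length F + (suc s + s)
              <⟨ ≤-reflexive (sym (+-suc (length F) _)) ⟩
            length F + suc (suc s + s)
              ≡⟨ cong (λ a → length F + suc a) (trans (sym (+-suc s s)) (cong (λ a → s + suc a) (sym (+-identityʳ s)))) ⟩
            length F + 2 * suc s
              ≤⟨ room ⟩
            N ∎
            where open ≤-Reasoning
        ... | y , y∉ = y , y∉ ∘ ∈-++⁺ˡ , y≢x , (λ i Bxy → y≢row i (proj₁ (proj₂ (rows i)) Bxy)) , safe-y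
          where
          y≢row : ∀ i → y ≢ proj₁ (rows i)
          y≢row i refl = y∉ (∈-++⁺ʳ F (∈-++⁺ˡ (∈-map⁺ (proj₁ ∘ rows) (∈-allFin i))))

          y≢x : y ≢ x
          y≢x refl = y≢row j (proj₁ (proj₂ (rows j)) Bx)

          safe-y : ∀ i → ¬ B i y (h x)
          safe-y i Byx with j ≟ i
          ... | yes refl = y≢x (B-inj Byx Bx)
          ... | no  j≢i  = y∉ (∈-++⁺ʳ F (∈-++⁺ʳ (map (proj₁ ∘ rows) (allFin (suc s)))
            (subst (_∈ map (proj₁ ∘ cols ∘ punchIn j) (allFin s))
              (sym (trans (proj₂ (cols i) Byx) (cong (proj₁ ∘ cols) (sym (punchIn-punchOut j≢i)))))
              (∈-map⁺ (proj₁ ∘ cols ∘ punchIn j) (∈-allFin (punchOut j≢i))))))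

      go : ∀ ps → ∃[ h ] Inj h × (∀ {p k} → R p k → h p ≡ k) × (∀ {p} → p ∈ ps → Safe h p)
      go [] = let h , h-inj , h-R = complete in h , h-inj , h-R , λ ()
      go (x ∷ ps) with go ps
      ... | h , h-inj , h-R , safe with any? (λ j → B? j x (h x))
      ...   | no none = h , h-inj , h-R , λ where
        (here refl) j Bx → none (j , Bx)
        (there p∈)       → safe p∈
      ...   | yes (j , Bx) with partner h h-inj x j Bx
      ...     | y , y∉F , y≢x , safe-x , safe-y = h ∘ transpose x y , transpose-inj x y ∘ h-inj , h′-R , safe′
        where
        -- Only `x` and `y` change values, and neither carries a prescription: `x` because it
        -- clashes, `y` because it lies outside `F`.
        h′-R : ∀ {p k} → R p k → h (transpose x y p) ≡ k
        h′-R {p} {k} = transpose-cases x y (λ p p′ → R p k → h p′ ≡ k)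
          (λ Rxk → contradiction Rxk (B-free Bx))
          (λ Ryk → contradiction (R⊆F Ryk) y∉F)
          (λ _ _ → h-R) p

        safe′ : ∀ {p} → p ∈ x ∷ ps → Safe (h ∘ transpose x y) p
        safe′ {p} p∈ i = transpose-cases x y (λ p p′ → p ∈ x ∷ ps → ¬ B i p (h p′))
          (λ _ → safe-x i)
          (λ _ → safe-y i)
          (λ { p≢x _ (here p≡x) → contradiction p≡x p≢x ; _ _ (there p∈) → safe p∈ i }) p p∈

-- Neighbourhoods in graphs without 4-cycles.

module _ {n : ℕ} (G : Graph (Fin n)) where

  adj⇒≢ : ∀ {x y} → Adj G x y → x ≢ y
  adj⇒≢ xy refl = irrefl G refl xy

  CommonUnique : Set
  CommonUnique = ∀ {a b x y} → a ≢ b → Adj G a x → Adj G b x → Adj G a y → Adj G b y → x ≡ y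

  -- Two different common neighbours `x`, `y` of `a` and `b` would close the cycle a, x, b, y.
  noC₄⇒commonUnique : ¬ Contains G C₄ → CommonUnique
  noC₄⇒commonUnique noC₄ {a} {b} {x} {y} a≢b ax bx ay by with x ≟ y
  ... | yes x≡y = x≡y
  ... | no  x≢y = contradiction (lookup corners , (λ {_} {_} → lookup-inj corners!) , (λ {_} {_} → edge)) noC₄
    where
    corners = a ∷ x ∷ b ∷ y ∷ []

    corners! : Unique corners
    corners! = (adj⇒≢ ax ∷ a≢b ∷ adj⇒≢ ay ∷ []) ∷ (adj⇒≢ (symm G bx) ∷ x≢y ∷ []) ∷ (adj⇒≢ by ∷ []) ∷ [] ∷ []

    edge : ∀ {u v} → Adj C₄ u v → Adj G (lookup corners u) (lookup corners v)
    edge (inj₁ (here refl))                         = ax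
    edge (inj₁ (there (here refl)))                 = symm G bx
    edge (inj₁ (there (there (here refl))))         = by
    edge (inj₁ (there (there (there (here refl))))) = symm G ay
    edge (inj₂ (here refl))                         = symm G ax
    edge (inj₂ (there (here refl)))                 = bx
    edge (inj₂ (there (there (here refl))))         = symm G by
    edge (inj₂ (there (there (there (here refl))))) = ay

  nbrs : Fin n → List (Fin n)
  nbrs x = filter (adj? G x) (allFin n)

  nbrs! : ∀ x → Unique (nbrs x)
  nbrs! x = filter⁺ (adj? G x) (allFin⁺ n)

  ∈nbrs⁺ : ∀ {x y} → Adj G x y → y ∈ nbrs x
  ∈nbrs⁺ {x} {y} = ∈-filter⁺ (adj? G x) (∈-allFin y)

  ∈nbrs⁻ : ∀ {x y} → y ∈ nbrs x → Adj G x y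
  ∈nbrs⁻ {x} = proj₂ ∘ ∈-filter⁻ (adj? G x) {xs = allFin n}

-- Partial colourings of regular graphs.

module RegularGraph {d n : ℕ} (G : Graph (Fin n)) (regular : Regular G d) where

  opaque

    -- An enumeration of the closed neighbourhood N[x] with `x` first. Regularity gives it the same
    -- index type as the colours, so an injective colouring of N[x] is a permutation of
    -- `Fin (suc d)`.
    closed : Fin n → Fin (suc d) → Fin n
    closed x p = lookup (x ∷ nbrs G x) (cast (cong suc (sym (regular x))) p)

    closed-zero : ∀ x → closed x zero ≡ x
    closed-zero x = refl

    closed-adj : ∀ x i → Adj G x (closed x (suc i))
    closed-adj x i = ∈nbrs⁻ G (∈-lookup (cast (sym (regular x)) i))

    closed-inj : ∀ x → Inj (closed x)
    closed-inj x {p} {q} eq = begin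
      p                     ≡⟨ Fin.cast-involutive (sym |closed|) |closed| p ⟨
      cast _ (cast |closed| p) ≡⟨ cong (cast (sym |closed|)) (lookup-inj closed! {cast |closed| p} {cast |closed| q} eq) ⟩
      cast _ (cast |closed| q) ≡⟨ Fin.cast-involutive (sym |closed|) |closed| q ⟩
      q ∎
      where
      open ≡-Reasoning
      |closed| : suc d ≡ suc (length (nbrs G x))
      |closed| = cong suc (sym (regular x))

      closed! : Unique (x ∷ nbrs G x)
      closed! = All.tabulate (adj⇒≢ G ∘ ∈nbrs⁻ G) ∷ nbrs! G x

    closed-surj : ∀ {x y} → Adj G x y → ∃[ i ] closed x (suc i) ≡ y
    closed-surj {x} xy = cast (regular x) (index (∈nbrs⁺ G xy)) ,
      trans (cong (lookup (nbrs G x)) (Fin.cast-involutive (sym (regular x)) (regular x) (index (∈nbrs⁺ G xy))))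
        (sym (lookup-index (∈nbrs⁺ G xy)))

  Near : Fin n → Fin n → Set
  Near x y = ∃[ p ] closed x p ≡ y

  near? : ∀ x y → Dec (Near x y)
  near? x y = any? λ p → closed x p ≟ y

  near-refl : ∀ {x} → Near x x
  near-refl {x} = zero , closed-zero x

  adj⇒near : ∀ {x y} → Adj G x y → Near x y
  adj⇒near xy = let i , eq = closed-surj xy in suc i , eq

  near⇒≡⊎adj : ∀ {x y} → Near x y → x ≡ y ⊎ Adj G x y
  near⇒≡⊎adj {x = x} (zero  , refl) = inj₁ (sym (closed-zero x))
  near⇒≡⊎adj {x = x} (suc i , refl) = inj₂ (closed-adj x i)

  near∧≢⇒adj : ∀ {x y} → Near x y → x ≢ y → Adj G x y
  near∧≢⇒adj near x≢y = [ (λ x≡y → contradiction x≡y x≢y) , id ] (near⇒≡⊎adj near)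

  Colour Partial : Set
  Colour  = Fin (suc d)
  Partial = Fin n → Maybe Colour

  PartialProper : Partial → Set
  PartialProper c = ∀ {u w k} → Adj G u w → c u ≡ just k → c w ≢ just k

  infix 4 _⊑_
  _⊑_ : Partial → Partial → Set
  c ⊑ c′ = ∀ {x k} → c x ≡ just k → c′ x ≡ just k

  -- In a d-regular graph coloured with d + 1 colours, a vertex sees all other colours
  -- iff its closed neighbourhood is coloured injectively.
  Rainbow : Partial → Fin n → Set
  Rainbow c x = ∃[ h ] Inj h × (∀ p → c (closed x p) ≡ just (h p))

  rainbow-⊑ : ∀ {c c′ x} → c ⊑ c′ → Rainbow c x → Rainbow c′ x
  rainbow-⊑ c⊑c′ (h , h-inj , ch) = h , h-inj , λ p → c⊑c′ (ch p)

  opaque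

    paint : Fin n → (Fin (suc d) → Colour) → Partial → Partial
    paint x h c w with near? x w
    ... | yes (p , _) = just (h p)
    ... | no  _       = c w

    paint-closed : ∀ {x h c} p → paint x h c (closed x p) ≡ just (h p)
    paint-closed {x} {h} p with near? x (closed x p)
    ... | yes (q , eq) = cong (just ∘ h) (closed-inj x eq)
    ... | no  ¬near    = contradiction (p , refl) ¬near

    paint-inv : ∀ {x h c w k} → paint x h c w ≡ just k → (∃[ p ] closed x p ≡ w × h p ≡ k) ⊎ (¬ Near x w × c w ≡ just k)
    paint-inv {x} {w = w} eq with near? x w
    ... | yes (p , xp≡w) = inj₁ (p , xp≡w , just-injective eq)
    ... | no  ¬near      = inj₂ (¬near , eq)

    paint-⊑ : ∀ {x h c} → (∀ {p k} → c (closed x p) ≡ just k → h p ≡ k) → c ⊑ paint x h c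
    paint-⊑ {x} agree {w} eq with near? x w
    ... | yes (p , refl) = cong just (agree eq)
    ... | no  _          = eq

  module _ {x : Fin n} {h : Fin (suc d) → Colour} {c : Partial}
    (agree : ∀ {p k} → c (closed x p) ≡ just k → h p ≡ k) (h-inj : Inj h) (proper : PartialProper c)
    (cross : ∀ {p w} → c (closed x p) ≡ nothing → ¬ Near x w → Adj G (closed x p) w → c w ≢ just (h p)) where

    -- Where the end in N[x] is already coloured, `agree` makes `h` repeat its colour and properness
    -- of `c` suffices; so `cross` is demanded at uncoloured positions only.
    boundary : ∀ {p w} → Adj G (closed x p) w → ¬ Near x w → c w ≢ just (h p)
    boundary {p} uw ¬near cw with c (closed x p) in eq
    ... | nothing = cross eq ¬near uw cw
    ... | just l  = proper uw (trans eq (cong just (sym (agree eq)))) cw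

    paint-proper : PartialProper (paint x h c)
    paint-proper uw cu cw with paint-inv cu | paint-inv cw
    ... | inj₁ (p , refl , refl) | inj₁ (q , refl , hq≡hp) = adj⇒≢ G uw (cong (closed x) (h-inj (sym hq≡hp)))
    ... | inj₁ (p , refl , refl) | inj₂ (¬near , cw)       = boundary uw ¬near cw
    ... | inj₂ (¬near , cu)      | inj₁ (p , refl , refl)  = boundary (symm G uw) ¬near cu
    ... | inj₂ (_ , cu)          | inj₂ (_ , cw)           = proper uw cu cw

-- Greedy extension to a full colouring.

module Extend {d n : ℕ} (G : Graph (Fin n)) (regular : Regular G d) where
  open RegularGraph G regular

  _↦_,_ : Fin n → Colour → Partial → Partial
  (x ↦ k , c) w with w ≟ x
  ... | yes _ = just k
  ... | no  _ = c w

  -- The `d` neighbours of `x` block at most `d` of the `d + 1` colours.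
  colourOne : ∀ c → PartialProper c → ∀ x → ∃[ c′ ] PartialProper c′ × c ⊑ c′ × ∃[ k ] c′ x ≡ just k
  colourOne c proper x with c x in cx
  ... | just k  = c , proper , id , k , cx
  ... | nothing with fresh (mapMaybe c (nbrs G x)) (s≤s (≤-trans (length-mapMaybe c (nbrs G x)) (≤-reflexive (regular x))))
  ...   | k , k∉ = (x ↦ k , c) , proper′ , keep , k , at-x
    where
    at-x : (x ↦ k , c) x ≡ just k
    at-x with x ≟ x
    ... | yes _   = refl
    ... | no  x≢x = contradiction refl x≢x

    keep : c ⊑ (x ↦ k , c)
    keep {w} cw with w ≟ x
    ... | yes refl = contradiction (trans (sym cx) cw) λ ()
    ... | no  _    = cw

    unused : ∀ {w} → Adj G x w → c w ≢ just k
    unused xw cw = k∉ (mapMaybe⁺ c (nbrs G x) (map⁺ (Any.map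
      (λ { refl → subst (Maybe.Any (k ≡_)) (sym cw) (Maybe.just refl) }) (∈nbrs⁺ G xw))))

    proper′ : PartialProper (x ↦ k , c)
    proper′ {u} {w} uw cu cw with u ≟ x | w ≟ x
    ... | yes refl | yes refl = irrefl G refl uw
    ... | no  _    | no  _    = proper uw cu cw
    ... | yes refl | no  _    = unused uw (trans cw (sym cu))
    ... | no  _    | yes refl = unused (symm G uw) (trans cu (sym cw))

  extend : ∀ c → PartialProper c → ∃[ C ] Proper G C × (∀ {x k} → c x ≡ just k → C x ≡ k)
  extend c proper with colourAll (allFin n)
    where
    colourAll : ∀ xs → ∃[ c′ ] PartialProper c′ × c ⊑ c′ × (∀ {x} → x ∈ xs → ∃[ k ] c′ x ≡ just k)
    colourAll []       = c , proper , id , λ ()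
    colourAll (x ∷ xs) with colourAll xs
    ... | c₁ , proper₁ , c⊑c₁ , all₁ with colourOne c₁ proper₁ x
    ...   | c₂ , proper₂ , c₁⊑c₂ , k , c₂x = c₂ , proper₂ , c₁⊑c₂ ∘ c⊑c₁ , λ where
      (here refl) → k , c₂x
      (there y∈)  → let l , c₁y = all₁ y∈ in l , c₁⊑c₂ c₁y
  ... | c′ , proper′ , c⊑c′ , total = C , C-proper , λ cx → just-injective (trans (sym (C-eq _)) (c⊑c′ cx))
    where
    C : Fin n → Colour
    C x = proj₁ (total (∈-allFin x))

    C-eq : ∀ x → c′ x ≡ just (C x)
    C-eq x = proj₂ (total (∈-allFin x))

    C-proper : Proper G C
    C-proper {u} {w} uw Cu≡Cw = proper′ uw (C-eq u) (trans (C-eq w) (cong just (sym Cu≡Cw)))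

  -- An injective colouring of N[z] with `d + 1` colours attains every colour; one different from
  -- that of `z` cannot sit at position `zero`, so it sits on a neighbour.
  hasBColoring : ∀ c → PartialProper c → (∀ k → ∃[ z ] c z ≡ just k × Rainbow c z) → HasBColoring G (suc d)
  hasBColoring c proper dominators with extend c proper
  ... | C , C-proper , C-extends = C , C-proper , dominates
    where
    dominates : ∀ i → ∃[ z ] C z ≡ i × (∀ j → j ≢ i → ∃[ u ] Adj G z u × C u ≡ j)
    dominates i with dominators i
    ... | z , cz , h , h-inj , ch = z , C-extends cz , sees
      where
      sees : ∀ j → j ≢ i → ∃[ u ] Adj G z u × C u ≡ j
      sees j j≢i with inj⇒surj h-inj j
      ... | zero  , refl = contradiction (just-injective (trans (sym (ch zero)) (trans (cong c (closed-zero z)) cz))) j≢i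
      ... | suc p , refl = closed z (suc p) , closed-adj z p , C-extends (ch (suc p))

-- Making neighbours of a vertex rainbow one after the other.

module Around {d n : ℕ} (G : Graph (Fin n)) (regular : Regular G d) (common : CommonUnique G) where
  open RegularGraph G regular

  module _ (v : Fin n) (h₀ : Fin (suc d) → Colour) (h₀-inj : Inj h₀) where

    -- The invariant of the induction on `ws`. The field `support` limits which coloured vertices
    -- the next neighbourhood can meet, and later confines the colouring to one side of the
    -- separating set.
    record ColouringAround (ws : List (Fin n)) : Set where
      field
        colouring : Partial
        proper    : PartialProper colouring
        centre    : ∀ p → colouring (closed v p) ≡ just (h₀ p)
        rainbow   : ∀ {w} → w ∈ ws → Rainbow colouring w
        support   : ∀ {x k} → colouring x ≡ just k → ∃[ z ] z ∈ v ∷ ws × Near z x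

    empty : Partial
    empty = const nothing

    start : ColouringAround []
    start = record
      { colouring = paint v h₀ empty
      ; proper    = paint-proper (λ ()) h₀-inj (λ _ ()) λ _ _ _ ()
      ; centre    = paint-closed
      ; rainbow   = λ ()
      ; support   = λ eq → startSupport (paint-inv eq)
      }

      where
      startSupport : ∀ {x k} → (∃[ p ] closed v p ≡ x × h₀ p ≡ k) ⊎ (¬ Near v x × nothing ≡ just k) →
        ∃[ z ] z ∈ v ∷ [] × Near z x
      startSupport (inj₁ (p , vp≡x , _)) = v , here refl , p , vp≡x

    module Step {ws : List (Fin n)} (vws : All (Adj G v) ws) {w : Fin n} (w∉ : w ∉ ws) (vw : Adj G v w)
      (room : 2 * suc (length ws) ≤ d) (around : ColouringAround ws) where
      open ColouringAround around renaming (colouring to c)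

      R : Fin (suc d) → Fin (suc d) → Set
      R p k = c (closed w p) ≡ just k

      R? : ∀ p → Dec (∃ (R p))
      R? p with c (closed w p)
      ... | just k  = yes (k , refl)
      ... | nothing = no λ ()

      -- A coloured `x` adjacent to `w` and to an earlier `z` must be `v`, since `v` is already a
      -- common neighbour of `w` and `z`.
      support-near : ∀ {x k} → Near w x → c x ≡ just k → Near v x
      support-near {x} wx cx with support cx
      ... | z , here refl , vx = vx
      ... | z , there z∈ , zx with near⇒≡⊎adj wx | near⇒≡⊎adj zx
      ...   | inj₁ refl | _         = adj⇒near vw
      ...   | inj₂ _    | inj₁ refl = adj⇒near (All.lookup vws z∈)
      ...   | inj₂ wx   | inj₂ zx   =
        subst (Near v) (common (λ { refl → w∉ z∈ }) (symm G vw) (symm G (All.lookup vws z∈)) wx zx) near-refl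

      -- The coloured vertices of N[w] lie in N[v], where `h₀` colours injectively.
      R-inj : ∀ {p p′ k} → R p k → R p′ k → p ≡ p′
      R-inj {p} {p′} cp cp′ with support-near (p , refl) cp | support-near (p′ , refl) cp′
      ... | q , vq | q′ , vq′ = closed-inj w (trans (sym vq) (trans (cong (closed v) (h₀-inj hq≡hq′)) vq′))
        where
        hq≡hq′ : h₀ q ≡ h₀ q′
        hq≡hq′ = just-injective (trans (trans (sym (centre q)) (trans (cong c vq) cp))
          (sym (trans (sym (centre q′)) (trans (cong c vq′) cp′))))

      -- The only coloured vertices of N[w] are w, v and possibly one common neighbour of v and w.
      v-pos : Fin (suc d)
      v-pos = proj₁ (adj⇒near (symm G vw))

      v-pos≡v : closed w v-pos ≡ v
      v-pos≡v = proj₂ (adj⇒near (symm G vw))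

      third : ∃[ q ] (∀ {p} → Near v (closed w p) → p ≢ zero → p ≢ v-pos → p ≡ q)
      third with any? (λ p → near? v (closed w p) ×-dec ¬? (p ≟ zero) ×-dec ¬? (p ≟ v-pos))
      -- Without a common neighbour of `v` and `w`, `zero` is a filler that `F` contains anyway.
      ... | no none = zero , λ vp p≢0 p≢v → contradiction (_ , vp , p≢0 , p≢v) none
      ... | yes (q , vq , q≢0 , q≢v) = q , λ vp p≢0 p≢v →
        closed-inj w (common (adj⇒≢ G vw) (v-adj vp p≢v) (w-adj p≢0) (v-adj vq q≢v) (w-adj q≢0))
        where
        v-adj : ∀ {p} → Near v (closed w p) → p ≢ v-pos → Adj G v (closed w p)
        v-adj vp p≢v = near∧≢⇒adj vp λ v≡ → p≢v (closed-inj w (trans (sym v≡) (sym v-pos≡v)))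

        w-adj : ∀ {p} → p ≢ zero → Adj G w (closed w p)
        w-adj p≢0 = near∧≢⇒adj (_ , refl) λ w≡ → p≢0 (closed-inj w (trans (sym w≡) (sym (closed-zero w))))

      F : List (Fin (suc d))
      F = zero ∷ v-pos ∷ proj₁ third ∷ []

      R⊆F : ∀ {p k} → R p k → p ∈ F
      R⊆F {p} cp with p ≟ zero | p ≟ v-pos
      ... | yes p≡0 | _       = here p≡0
      ... | no  _   | yes p≡v = there (here p≡v)
      ... | no  p≢0 | no  p≢v = there (there (here (proj₂ third (support-near (p , refl) cp) p≢0 p≢v)))

      w_ : Fin (length ws) → Fin n
      w_ = lookup ws

      -- The conflict relation for `completeAvoiding`: an outside neighbour in N[z] bars the colour
      -- `k` at `p`. The vertex `w` is exempt: conflicts inside N[w] are settled by injectivity, and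
      -- `B-inj` compares common neighbours of `w` and a vertex other than `w`.
      Clash : Fin n → Fin (suc d) → Colour → Set
      Clash z p k = c (closed w p) ≡ nothing ×
        ∃[ q ] Adj G (closed w p) (closed z q) × c (closed z q) ≡ just k × closed z q ≢ w

      B : Fin (length ws) → Fin (suc d) → Colour → Set
      B j = Clash (w_ j)

      B? : ∀ j p k → Dec (B j p k)
      B? j p k = ≡-dec _≟_ (c (closed w p)) nothing ×-dec any? λ q →
        adj? G (closed w p) (closed (w_ j) q) ×-dec ≡-dec _≟_ (c (closed (w_ j) q)) (just k) ×-dec ¬? (closed (w_ j) q ≟ w)

      coloured-w_ : ∀ j q → c (closed (w_ j) q) ≢ nothing
      coloured-w_ j q eq with rainbow (∈-lookup {xs = ws} j)
      ... | h , _ , ch = contradiction (trans (sym (ch q)) eq) λ ()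

      uncoloured⇒≢w_ : ∀ {j x} → c x ≡ nothing → ∀ q → x ≢ closed (w_ j) q
      uncoloured⇒≢w_ {j} cx q refl = coloured-w_ j q cx

      uncoloured⇒≢near-v : ∀ {x y} → c x ≡ nothing → Near v y → x ≢ y
      uncoloured⇒≢near-v cx (q , refl) refl = contradiction (trans (sym (centre q)) cx) λ ()

      uncoloured-adj : ∀ {p} → c (closed w p) ≡ nothing → Adj G w (closed w p)
      uncoloured-adj cx = near∧≢⇒adj (_ , refl) (uncoloured⇒≢near-v cx (adj⇒near vw) ∘ sym)

      -- An uncoloured vertex is not adjacent to `w_ j`, as N[w_ j] is fully coloured. Its
      -- neighbours in N[w_ j] are therefore common neighbours with `w_ j`, and there is at most
      -- one.
      B-fun : ∀ {j p k k′} → B j p k → B j p k′ → k ≡ k′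
      B-fun {j} (cx , q , xq , cq , _) (_ , q′ , xq′ , cq′ , _) = just-injective (trans (sym cq) (trans (cong c q≡q′) cq′))
        where
        w-adj : ∀ {q} → Adj G (closed w _) (closed (w_ j) q) → Adj G (w_ j) (closed (w_ j) q)
        w-adj {q} xq = near∧≢⇒adj (q , refl) λ wⱼ≡q →
          let i , eq = adj⇒near (symm G (subst (Adj G _) (sym wⱼ≡q) xq)) in uncoloured⇒≢w_ cx i (sym eq)

        q≡q′ : closed (w_ j) q ≡ closed (w_ j) q′
        q≡q′ = common (λ x≡ → uncoloured⇒≢w_ cx zero (trans x≡ (sym (closed-zero _)))) xq (w-adj xq) xq′ (w-adj xq′)

      -- As N[w_ j] is rainbow, the colour `k` sits on a single vertex there. This vertex differs
      -- from `w`, so the two have at most one common neighbour.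
      B-inj : ∀ {j p p′ k} → B j p k → B j p′ k → p ≡ p′
      B-inj {j} {p} {p′} (cx , q , xq , cq , q≢w) (cx′ , q′ , xq′ , cq′ , _) with rainbow (∈-lookup {xs = ws} j)
      ... | h , h-inj , ch = closed-inj w (common q≢w (symm G xq) (uncoloured-adj cx) (symm G xq″) (uncoloured-adj cx′))
        where
        q′≡q : q′ ≡ q
        q′≡q = h-inj (just-injective (trans (sym (ch q′)) (trans cq′ (sym (trans (sym (ch q)) cq)))))

        xq″ : Adj G (closed w p′) (closed (w_ j) q)
        xq″ = subst (Adj G _ ∘ closed (w_ j)) q′≡q xq′

      B-free : ∀ {j p k l} → B j p k → ¬ R p l
      B-free (cx , _) cp = contradiction (trans (sym cx) cp) λ ()

      R-fun : ∀ {p k k′} → R p k → R p k′ → k ≡ k′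
      R-fun cp cp′ = just-injective (trans (sym cp) cp′)

      step : ColouringAround (w ∷ ws)
      -- Since `F` has three entries, `3 + 2 * length ws ≤ d + 1` is what must hold, and this is
      -- `room`.
      step with Completion.completeAvoiding R R? R-fun R-inj B B? B-fun B-inj B-free F R⊆F
                  (s≤s (≤-trans (≤-reflexive (sym (*-suc 2 (length ws)))) room))
      ... | h , h-inj , h-R , safe = record
        { colouring = paint w h c
        ; proper    = paint-proper h-R h-inj proper cross
        ; centre    = λ p → grow (centre p)
        ; rainbow   = λ { (here refl) → h , h-inj , paint-closed ; (there u∈) → rainbow-⊑ {c} {paint w h c} grow (rainbow u∈) }
        ; support   = λ eq → supp (paint-inv eq)
        }
        where
        grow : c ⊑ paint w h c
        grow = paint-⊑ h-R

        supp : ∀ {x k} → (∃[ p ] closed w p ≡ x × h p ≡ k) ⊎ (¬ Near w x × c x ≡ just k) →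
          ∃[ z ] z ∈ v ∷ w ∷ ws × Near z x
        supp (inj₁ (p , wp≡x , _)) = w , there (here refl) , p , wp≡x
        supp (inj₂ (_ , cx)) with support cx
        ... | z , here refl , zx = z , here refl , zx
        ... | z , there z∈  , zx = z , there (there z∈) , zx

        cross : ∀ {p y} → c (closed w p) ≡ nothing → ¬ Near w y → Adj G (closed w p) y → c y ≢ just (h p)
        cross {p} cx ¬wy xy cy with support cy
        -- A conflict with N[v] cannot arise: `w` and `y` would be two common neighbours of `v` and
        -- the uncoloured vertex.
        ... | _ , here refl , vy = ¬wy (subst (Near w) w≡y near-refl)
          where
          w≡y = common (uncoloured⇒≢near-v cx near-refl) (symm G (uncoloured-adj cx)) vw xy
            (near∧≢⇒adj vy λ { refl → ¬wy (adj⇒near (symm G vw)) })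
        ... | z , there z∈ , (q , refl) = safe p (index z∈)
          (subst (λ z → Clash z p (h p)) (lookup-index z∈)
            (cx , q , xy , cy , λ y≡w → ¬wy (subst (Near w) (sym y≡w) near-refl)))

    colourAround : ∀ {ws} → Unique ws → All (Adj G v) ws → 2 * length ws ≤ d → ColouringAround ws
    colourAround []         []         room = start
    colourAround {w ∷ ws} (w∉ ∷ ws!) (vw ∷ vws) room =
      Step.step vws (λ w∈ → All.lookup w∉ w∈ refl) vw room
        (colourAround ws! vws (≤-trans (≤-trans (n≤1+n _) (≤-trans (n≤1+n _) (≤-reflexive (sym (*-suc 2 (length ws)))))) room))

-- Counting in lists, and the sides of a separating set.

length-filter-¬ : ∀ {A : Set} {P : A → Set} (P? : Decidable P) xs →
  length (filter P? xs) + length (filter (¬? ∘ P?) xs) ≡ length xs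
length-filter-¬ P? []       = refl
length-filter-¬ P? (x ∷ xs) with P? x
... | yes _ = cong suc (length-filter-¬ P? xs)
... | no  _ = trans (+-suc _ _) (cong suc (length-filter-¬ P? xs))

unique-⊆⇒length≤ : ∀ {A : Set} {xs ys : List A} → Unique xs → (∀ {x} → x ∈ xs → x ∈ ys) → length xs ≤ length ys
unique-⊆⇒length≤ {xs = xs} {ys} xs! xs⊆ys = injective⇒≤ {f = λ i → index (xs⊆ys (∈-lookup i))} λ {i} {j} eq →
  lookup-inj xs! (trans (lookup-index (xs⊆ys (∈-lookup i)))
    (trans (cong (lookup ys) eq) (sym (lookup-index (xs⊆ys (∈-lookup j))))))

pair! : ∀ {A : Set} {x y : A} → x ≢ y → Unique (x ∷ y ∷ [])
pair! x≢y = (x≢y ∷ []) ∷ [] ∷ []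

two : ∀ {A : Set} {xs : List A} → Unique xs → 2 ≤ length xs → ∃[ x ] ∃[ y ] x ∈ xs × y ∈ xs × x ≢ y
two {xs = _ ∷ _ ∷ _} ((x≢y ∷ _) ∷ _) (s≤s (s≤s _)) = _ , _ , here refl , there (here refl) , x≢y

one : ∀ {A : Set} {xs : List A} → 1 ≤ length xs → ∃[ x ] x ∈ xs
one {xs = _ ∷ _} (s≤s _) = _ , here refl

-- A union of components of the graph without `U`, neither empty nor everything. Both halves of a
-- disconnection have this form, so each argument serves both.
record Side {n} (G : Graph (Fin n)) (U : Subset n) : Set₁ where
  field
    In      : Fin n → Set
    in?     : Decidable In
    out     : ∀ {x} → In x → x Subset.∉ U
    border   : ∀ {x y} → In x → Adj G x y → In y ⊎ y Subset.∈ U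
    point   : ∃ In
    other   : ∃[ y ] ¬ In y × y Subset.∉ U

Reaches : ∀ {n} → Graph (Fin n) → Subset n → Fin n → Set
Reaches G U x = ∃[ u ] u Subset.∈ U × Adj G x u

reaches? : ∀ {n} (G : Graph (Fin n)) U → Decidable (Reaches G U)
reaches? G U x = any? λ u → (u ∈? U) ×-dec adj? G x u

-- Finding a vertex with no neighbour in the separating set.

module GoodVertex {d n : ℕ} (G : Graph (Fin n)) (regular : Regular G d) (common : CommonUnique G)
  {U : Subset n} (2≤d : 2 ≤ d) (small : 2 * ∣ U ∣ ≤ suc d)
  (connected : 1 ≤ ∣ U ∣ → (P : Fin n → Set) → (∀ {x y} → P x → Adj G x y → P y) → ∀ {x} → P x → ∀ y → ¬ ¬ P y)
  (side : Side G U) where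
  open Side side

  module AllReach (reaches : ∀ {x} → In x → Reaches G U x) where

    outer inner : Fin n → List (Fin n)
    outer x = filter (_∈? U) (nbrs G x)
    inner x = filter (¬? ∘ (_∈? U)) (nbrs G x)

    outer! : ∀ x → Unique (outer x)
    outer! x = filter⁺ (_∈? U) (nbrs! G x)

    inner! : ∀ x → Unique (inner x)
    inner! x = filter⁺ (¬? ∘ (_∈? U)) (nbrs! G x)

    outer⁻ : ∀ {x u} → u ∈ outer x → Adj G x u × u Subset.∈ U
    outer⁻ {x} u∈ = let u∈nbrs , u∈U = ∈-filter⁻ (_∈? U) {xs = nbrs G x} u∈ in ∈nbrs⁻ G u∈nbrs , u∈U

    outer⁺ : ∀ {x u} → Adj G x u → u Subset.∈ U → u ∈ outer x
    outer⁺ xu u∈U = ∈-filter⁺ (_∈? U) (∈nbrs⁺ G xu) u∈U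

    inner⁻ : ∀ {x y} → In x → y ∈ inner x → Adj G x y × In y
    inner⁻ {x} Ix y∈ with ∈-filter⁻ (¬? ∘ (_∈? U)) {xs = nbrs G x} y∈
    ... | y∈nbrs , y∉U with border Ix (∈nbrs⁻ G y∈nbrs)
    ...   | inj₁ Iy  = ∈nbrs⁻ G y∈nbrs , Iy
    ...   | inj₂ y∈U = contradiction y∈U y∉U

    inner⁺ : ∀ {x y} → Adj G x y → In y → y ∈ inner x
    inner⁺ xy Iy = ∈-filter⁺ (¬? ∘ (_∈? U)) (∈nbrs⁺ G xy) (out Iy)

    In≢U : ∀ {x u} → In x → u Subset.∈ U → x ≢ u
    In≢U Ix u∈U refl = out Ix u∈U

    outer+inner : ∀ x → length (outer x) + length (inner x) ≡ d
    outer+inner x = trans (length-filter-¬ (_∈? U) (nbrs G x)) (regular x)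

    outer≤ : ∀ x → length (outer x) ≤ ∣ U ∣
    outer≤ x = ⊆⇒length≤card (outer! x) U (proj₂ ∘ outer⁻)

    -- Different inner neighbours of `x` use different `u`, because `x` and `u` have at most one
    -- common neighbour. Allowing `V` smaller than `U` pays off in `towards`.
    innerVia : ∀ {x} → In x → (V : Subset n) →
      (∀ {y} → y ∈ inner x → ∃[ u ] u Subset.∈ V × Adj G y u × u Subset.∈ U) → length (inner x) ≤ ∣ V ∣
    innerVia {x} Ix V hit = length≤card (λ y u → Adj G x y × Adj G y u × u Subset.∈ U)
      (λ { (xy , yu , u∈U) (xy′ , yu′ , _) → common (In≢U Ix u∈U) xy (symm G yu) xy′ (symm G yu′) })
      (inner! x) V λ y∈ → let u , u∈V , yu , u∈U = hit y∈ in u , u∈V , proj₁ (inner⁻ Ix y∈) , yu , u∈U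

    inner≤ : ∀ {x} → In x → length (inner x) ≤ ∣ U ∣
    inner≤ {x} Ix = innerVia Ix U λ y∈ → let u , u∈U , yu = reaches (proj₂ (inner⁻ Ix y∈)) in u , u∈U , yu , u∈U

    outer≥ : ∀ {x} → In x → d ≤ length (outer x) + ∣ U ∣
    outer≥ {x} Ix = subst (_≤ _) (outer+inner x) (+-monoʳ-≤ (length (outer x)) (inner≤ Ix))

    outer>0 : ∀ {x} → In x → 1 ≤ length (outer x)
    outer>0 Ix with reaches Ix
    ... | u , u∈U , xu = unique-⊆⇒length≤ ([] ∷ []) λ { (here refl) → outer⁺ xu u∈U }

    -- A vertex of `U` adjacent to both `y` and `z` would be a second common neighbour besides `x`,
    -- so the two outer lists are disjoint parts of `U`.
    siblings : ∀ {x y z} → In x → y ∈ inner x → z ∈ inner x → y ≢ z → length (outer y) + length (outer z) ≤ ∣ U ∣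
    siblings {x} {y} {z} Ix y∈ z∈ y≢z = subst (_≤ ∣ U ∣) (length-++ (outer y)) (⊆⇒length≤card
      (++⁺ (outer! y) (outer! z) disjoint) U λ u∈ → [ proj₂ ∘ outer⁻ , proj₂ ∘ outer⁻ {z} ] (∈-++⁻ (outer y) u∈))
      where
      disjoint : ∀ {u} → ¬ (u ∈ outer y × u ∈ outer z)
      disjoint (u∈y , u∈z) with outer⁻ u∈y | outer⁻ {z} u∈z
      ... | yu , u∈U | zu , _ =
        In≢U Ix u∈U (common y≢z (symm G (proj₁ (inner⁻ Ix y∈))) (symm G (proj₁ (inner⁻ Ix z∈))) yu zu)

    saturated : ∀ {x ys} → Unique ys → All (Adj G x) ys → d ≤ length ys → ∀ {z} → Adj G x z → z ∈ ys
    saturated {x} {ys} ys! xys d≤ {z} xz with Any.any? (z ≟_) ys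
    ... | yes z∈ = z∈
    ... | no  z∉ = contradiction (≤-trans (s≤s d≤) (subst (suc (length ys) ≤_) (regular x)
      (unique-⊆⇒length≤ (All.tabulate (λ y∈ z≡y → z∉ (subst (_∈ ys) (sym z≡y) y∈)) ∷ ys!)
        λ { (here refl) → ∈nbrs⁺ G xz ; (there y∈) → ∈nbrs⁺ G (All.lookup xys y∈) }))) 1+n≰n

    -- Write k for `∣ U ∣`. If d ≥ k + 2, some vertex has two inner neighbours; each has at least d
    -- - k outer ones, all distinct, so 2(d - k) ≤ k. Then k ≥ 4 and 2(d + 1) ≤ 3k + 2 < 4k, against
    -- `small`.
    d≤1+|U| : ¬ (2 + ∣ U ∣ ≤ d)
    d≤1+|U| 2+k≤d with point
    ... | a , Ia with two (inner! a) 2≤inner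
      where
      2≤inner : 2 ≤ length (inner a)
      2≤inner = +-cancelˡ-≤ ∣ U ∣ _ _ (≤-trans (≤-reflexive (+-comm ∣ U ∣ 2)) (≤-trans 2+k≤d
        (≤-trans (≤-reflexive (sym (outer+inner a))) (+-monoˡ-≤ _ (outer≤ a)))))
    ...   | y , z , y∈ , z∈ , y≢z = contradiction small (<⇒≱ arith)
      where
      k = ∣ U ∣
      open ≤-Reasoning
      2d≤3k : d + d ≤ k + (k + k)
      2d≤3k = begin
        d + d ≤⟨ +-mono-≤ (outer≥ (proj₂ (inner⁻ Ia y∈))) (outer≥ (proj₂ (inner⁻ Ia z∈))) ⟩
        (length (outer y) + k) + (length (outer z) + k)
          ≡⟨ solve 3 (λ a b k → (a :+ k) :+ (b :+ k) := (a :+ b) :+ (k :+ k)) refl (length (outer y)) (length (outer z)) k ⟩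
        (length (outer y) + length (outer z)) + (k + k) ≤⟨ +-monoˡ-≤ (k + k) (siblings Ia y∈ z∈ y≢z) ⟩
        k + (k + k) ∎

      4≤k : 4 ≤ k
      4≤k = +-cancelʳ-≤ (k + k) 4 k (begin
        4 + (k + k)       ≡⟨ solve 1 (λ k → con 4 :+ (k :+ k) := (con 2 :+ k) :+ (con 2 :+ k)) refl k ⟩
        (2 + k) + (2 + k) ≤⟨ +-mono-≤ 2+k≤d 2+k≤d ⟩
        d + d             ≤⟨ 2d≤3k ⟩
        k + (k + k)       ∎)

      arith : suc d < 2 * k
      arith = *-cancelˡ-< 2 (suc d) (2 * k) (begin-strict
        2 * suc d         ≡⟨ solve 1 (λ d → con 2 :* (con 1 :+ d) := (d :+ d) :+ con 2) refl d ⟩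
        d + d + 2         ≤⟨ +-monoˡ-≤ 2 2d≤3k ⟩
        k + (k + k) + 2   <⟨ +-monoʳ-< (k + (k + k)) (≤-trans (s≤s (s≤s (s≤s z≤n))) 4≤k) ⟩
        k + (k + k) + k   ≡⟨ solve 1 (λ k → k :+ (k :+ k) :+ k := con 2 :* (con 2 :* k)) refl k ⟩
        2 * (2 * k)       ∎)

    one-inner : ∀ {x} → In x → suc ∣ U ∣ ≤ d → 1 ≤ length (inner x)
    one-inner {x} Ix k<d = +-cancelˡ-≤ ∣ U ∣ _ _ (≤-trans (≤-reflexive (+-comm ∣ U ∣ 1)) (≤-trans k<d
      (≤-trans (≤-reflexive (sym (outer+inner x))) (+-monoˡ-≤ _ (outer≤ x)))))

    -- Both `a` and its inner neighbour `b` are adjacent to the only vertex `u` of `U`. In a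
    -- 2-regular graph the triangle a, b, u is a whole component, yet it misses the vertex from
    -- `other`.
    triangle : d ≡ 2 → ∣ U ∣ ≡ 1 → ¬ ∃ In
    triangle refl |U|≡1 (a , Ia) with reaches Ia | one (one-inner Ia (≤-reflexive (cong suc |U|≡1)))
    ... | u , u∈U , au | b , b∈ with reaches (proj₂ (inner⁻ Ia b∈))
    ...   | u′ , u′∈U , bu′ = connected (≤-reflexive (sym |U|≡1)) (_∈ a ∷ b ∷ u ∷ []) stays (here refl) (proj₁ other) λ
      { (here refl)                 → proj₁ (proj₂ other) Ia
      ; (there (here refl))         → proj₁ (proj₂ other) Ib
      ; (there (there (here refl))) → proj₂ (proj₂ other) u∈U }
      where
      ab = proj₁ (inner⁻ Ia b∈)
      Ib = proj₂ (inner⁻ Ia b∈)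

      u′≡u : u′ ≡ u
      u′≡u with u′ ≟ u
      ... | yes eq = eq
      ... | no  u′≢u = contradiction (subst (2 ≤_) |U|≡1 (⊆⇒length≤card (pair! u′≢u) U
        λ { (here refl) → u′∈U ; (there (here refl)) → u∈U })) 1+n≰n

      bu : Adj G b u
      bu = subst (Adj G b) u′≡u bu′

      stays : ∀ {x y} → x ∈ a ∷ b ∷ u ∷ [] → Adj G x y → y ∈ a ∷ b ∷ u ∷ []
      stays (here refl) xy = there (saturated (pair! (In≢U Ib u∈U)) (ab ∷ au ∷ []) ≤-refl xy)
      stays (there (here refl)) xy with saturated (pair! (In≢U Ia u∈U)) (symm G ab ∷ bu ∷ []) ≤-refl xy
      ... | here refl         = here refl
      ... | there (here refl) = there (there (here refl))
      stays (there (there (here refl))) xy with saturated (pair! (adj⇒≢ G ab)) (symm G au ∷ symm G bu ∷ []) ≤-refl xy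
      ... | here refl         = here refl
      ... | there (here refl) = there (here refl)

    module Cubic (d≡3 : d ≡ 3) (|U|≡2 : ∣ U ∣ ≡ 2) where

      three : ∀ {u v w} → u Subset.∈ U → v Subset.∈ U → w Subset.∈ U → u ≢ v → w ≡ u ⊎ w ≡ v
      three {u} {v} {w} u∈ v∈ w∈ u≢v with w ≟ u | w ≟ v
      ... | yes w≡u | _       = inj₁ w≡u
      ... | no  _   | yes w≡v = inj₂ w≡v
      ... | no  w≢u | no  w≢v = contradiction (subst (3 ≤_) |U|≡2 (⊆⇒length≤card ((w≢u ∷ w≢v ∷ []) ∷ pair! u≢v) U
        λ { (here refl) → w∈ ; (there (here refl)) → u∈ ; (there (there (here refl))) → v∈ })) 1+n≰n

      inner≥2 : ∀ {x} → length (outer x) ≤ 1 → 2 ≤ length (inner x)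
      inner≥2 {x} o≤1 = +-cancelˡ-≤ 1 _ _ (≤-trans (≤-reflexive (sym (trans (outer+inner x) d≡3))) (+-monoˡ-≤ _ o≤1))

      shared : ∀ {x y} → In x → In y → x ≢ y → 2 ≤ length (outer x) → ¬ (2 ≤ length (outer y))
      shared {x} {y} Ix Iy x≢y 2≤x 2≤y with two (outer! x) 2≤x | two (outer! y) 2≤y
      ... | u₁ , u₂ , u₁∈ , u₂∈ , u₁≢u₂ | v₁ , v₂ , v₁∈ , v₂∈ , v₁≢v₂ =
        v₁≢v₂ (common x≢y (xv v₁∈) (proj₁ (outer⁻ v₁∈)) (xv v₂∈) (proj₁ (outer⁻ v₂∈)))
        where
        xv : ∀ {v} → v ∈ outer y → Adj G x v
        xv v∈ with three (proj₂ (outer⁻ u₁∈)) (proj₂ (outer⁻ u₂∈)) (proj₂ (outer⁻ {y} v∈)) u₁≢u₂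
        ... | inj₁ refl = proj₁ (outer⁻ u₁∈)
        ... | inj₂ refl = proj₁ (outer⁻ u₂∈)

      crowded : ∀ {x y z} → In y → x ∈ inner y → z ∈ inner y → x ≢ z → ¬ (2 ≤ length (outer x))
      crowded Iy x∈ z∈ x≢z 2≤ = 1+n≰n (subst (3 ≤_) |U|≡2
        (≤-trans (+-mono-≤ 2≤ (outer>0 (proj₂ (inner⁻ Iy z∈)))) (siblings Iy x∈ z∈ x≢z)))

      -- Suppose `x` is adjacent to both vertices of `U`. By `shared`, its inner neighbour `y` is
      -- not, so `y` has a second inner neighbour besides `x`; this one and `x` would need three
      -- vertices of `U` by `siblings`.
      outer≤1 : ∀ {x} → In x → length (outer x) ≤ 1
      outer≤1 {x} Ix with 2 ≤? length (outer x)
      ... | no  2≰ = ℕ.s≤s⁻¹ (≰⇒> 2≰)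
      ... | yes 2≤ with one (one-inner Ix (≤-reflexive (trans (cong suc |U|≡2) (sym d≡3))))
      ...   | y , y∈ with inner⁻ Ix y∈
      ...     | xy , Iy with two (inner! y) (inner≥2 {y} (ℕ.s≤s⁻¹ (≰⇒> (shared Ix Iy (adj⇒≢ G xy) 2≤))))
      ...       | z₁ , z₂ , z₁∈ , z₂∈ , z₁≢z₂ with x ≟ z₁
      ...         | yes refl = contradiction 2≤ (crowded Iy z₁∈ z₂∈ z₁≢z₂)
      ...         | no  x≢z₁ = contradiction 2≤ (crowded Iy (inner⁺ (symm G xy) Ix) z₁∈ x≢z₁)

      unique-reach : ∀ {x u v} → In x → u Subset.∈ U → v Subset.∈ U → Adj G x u → Adj G x v → u ≡ v
      unique-reach {x} {u} {v} Ix u∈ v∈ xu xv with u ≟ v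
      ... | yes u≡v = u≡v
      ... | no  u≢v = contradiction (≤-trans (unique-⊆⇒length≤ (pair! u≢v)
        (λ { (here refl) → outer⁺ xu u∈ ; (there (here refl)) → outer⁺ xv v∈ })) (outer≤1 Ix)) 1+n≰n

      -- Otherwise the two or more inner neighbours of `x` would all reach `U - u`, a single vertex,
      -- against `innerVia`.
      towards : ∀ {x u} → In x → u Subset.∈ U → ∃[ y ] Adj G x y × In y × Adj G y u
      towards {x} {u} Ix u∈U with any? (λ y → adj? G x y ×-dec in? y ×-dec adj? G y u)
      ... | yes found = found
      ... | no  none  = contradiction (≤-trans (inner≥2 {x} (outer≤1 Ix)) (innerVia Ix (U - u) hit))
        (<⇒≱ (subst (suc ∣ U - u ∣ ≤_) |U|≡2 (x∈p⇒∣p-x∣<∣p∣ u∈U)))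
        where
        hit : ∀ {y} → y ∈ inner x → ∃[ v ] v Subset.∈ (U - u) × Adj G y v × v Subset.∈ U
        hit y∈ with inner⁻ Ix y∈
        ... | xy , Iy with reaches Iy
        ...   | v , v∈U , yv = v , x∈p∧x≢y⇒x∈p-y v∈U (λ { refl → none (_ , xy , Iy , yv) }) , yv , v∈U

      -- Stepping repeatedly to a neighbour adjacent to v yields four neighbours c, c₁, b₁, b₂ of v.
      chase : ∀ {a b c u v} → In a → In b → In c → u Subset.∈ U → v Subset.∈ U → u ≢ v →
        Adj G a u → Adj G a b → Adj G b u → Adj G a c → ¬ Adj G c v
      chase {a} {b} {c} {u} {v} Ia Ib Ic u∈ v∈ u≢v au ab bu ac cv
        with towards Ic v∈ | towards Ib v∈
      ... | c₁ , cc₁ , Ic₁ , c₁v | b₁ , bb₁ , Ib₁ , b₁v with towards Ib₁ v∈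
      ...   | b₂ , b₁b₂ , Ib₂ , b₂v = 1+n≰n (subst (4 ≤_) (trans (regular v) d≡3) (unique-⊆⇒length≤ four! four⊆))
        where
        c≢b₁ : c ≢ b₁
        c≢b₁ refl = In≢U Ic u∈ (common (adj⇒≢ G ab) ac bb₁ au bu)

        -- If they agreed, `b` and `c` would both be common neighbours of `a` and `c₁`, hence equal
        -- and adjacent to both `u` and `v`.
        c₁≢b₁ : c₁ ≢ b₁
        c₁≢b₁ refl = u≢v (unique-reach Ic u∈ v∈ (subst (λ x → Adj G x u) b≡c bu) cv)
          where
          b≡c = common (λ { refl → u≢v (unique-reach Ia u∈ v∈ au c₁v) }) ab (symm G bb₁) ac (symm G cc₁)

        c≢b₂ : c ≢ b₂
        c≢b₂ refl = c₁≢b₁ (common (In≢U Ic v∈) cc₁ (symm G c₁v) (symm G b₁b₂) (symm G b₁v))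

        c₁≢b₂ : c₁ ≢ b₂
        c₁≢b₂ refl = c≢b₁ (common (In≢U Ic₁ v∈) (symm G cc₁) (symm G cv) (symm G b₁b₂) (symm G b₁v))

        four! : Unique (c ∷ c₁ ∷ b₁ ∷ b₂ ∷ [])
        four! = (adj⇒≢ G cc₁ ∷ c≢b₁ ∷ c≢b₂ ∷ []) ∷ (c₁≢b₁ ∷ c₁≢b₂ ∷ []) ∷ pair! (adj⇒≢ G b₁b₂)

        four⊆ : ∀ {x} → x ∈ c ∷ c₁ ∷ b₁ ∷ b₂ ∷ [] → x ∈ nbrs G v
        four⊆ (here refl)                         = ∈nbrs⁺ G (symm G cv)
        four⊆ (there (here refl))                 = ∈nbrs⁺ G (symm G c₁v)
        four⊆ (there (there (here refl)))         = ∈nbrs⁺ G (symm G b₁v)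
        four⊆ (there (there (there (here refl)))) = ∈nbrs⁺ G (symm G b₂v)

      u≢v : ∀ {a b c u v} → In a → b ≢ c → Adj G a b → Adj G a c → u Subset.∈ U → Adj G b u → Adj G c v → u ≢ v
      u≢v Ia b≢c ab ac u∈ bu cv refl = In≢U Ia u∈ (common b≢c (symm G ab) (symm G ac) bu cv)

      impossible : ¬ ∃ In
      impossible (a , Ia) with two (inner! a) (inner≥2 {a} (outer≤1 Ia))
      ... | b , c , b∈ , c∈ , b≢c with inner⁻ Ia b∈ | inner⁻ Ia c∈ | reaches Ia
      ...   | ab , Ib | ac , Ic | w , w∈ , aw with reaches Ib | reaches Ic
      ...     | u , u∈ , bu | v , v∈ , cv with u≢v Ia b≢c ab ac u∈ bu cv
      -- As `U` is {u, v}, the vertex `a` shares its neighbour in `U` with `b` or with `c`; the two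
      -- cases swap roles in `chase`.
      ...       | u≢v with three u∈ v∈ w∈ u≢v
      ...         | inj₁ refl = chase Ia Ib Ic u∈ v∈ u≢v aw ab bu ac cv
      ...         | inj₂ refl = chase Ia Ic Ib v∈ u∈ (u≢v ∘ sym) aw ac cv ab bu

    -- From 2k ≤ d + 1 and d ≤ k + 1 follows k ≤ 2. With d ≥ 2 only (k, d) = (1, 2) and (2, 3)
    -- remain, the triangle and the cubic case.
    contradictory : ∀ {k} → ∣ U ∣ ≡ k → ¬ (2 + k ≤ d) → ⊥
    contradictory |U|≡k d≤1+k with subst (λ k → 2 * k ≤ suc d) |U|≡k small | ℕ.s≤s⁻¹ (≰⇒> d≤1+k)
    contradictory {0} _     _ | _ | d≤1   = 1+n≰n (≤-trans 2≤d d≤1)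
    contradictory {1} |U|≡1 _ | _ | d≤2   = triangle (≤-antisym d≤2 2≤d) |U|≡1 point
    contradictory {2} |U|≡2 _ | 4≤ | d≤3  = Cubic.impossible (≤-antisym d≤3 (ℕ.s≤s⁻¹ 4≤)) |U|≡2 point
    contradictory {suc (suc (suc k))} _ _ | 2k≤ | d≤ = 1+n≰n (begin
      6 + k       ≤⟨ m≤n+m (6 + k) k ⟩
      k + (6 + k) ≡⟨ solve 1 (λ k → k :+ (con 6 :+ k) := con 2 :* (con 3 :+ k)) refl k ⟩
      2 * (3 + k) ≤⟨ 2k≤ ⟩
      suc d       ≤⟨ s≤s d≤ ⟩
      5 + k       ∎)
      where open ≤-Reasoning

  goodVertex : ∃[ v ] In v × (∀ {u} → Adj G v u → u Subset.∉ U)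
  goodVertex with any? (λ v → in? v ×-dec ¬? (reaches? G U v))
  ... | yes (v , Iv , ¬reaches) = v , Iv , λ vu u∈U → ¬reaches (_ , u∈U , vu)
  ... | no  none = contradiction (AllReach.d≤1+|U| reaches) (AllReach.contradictory reaches refl)
    where
    reaches : ∀ {x} → In x → Reaches G U x
    reaches {x} Ix = decidable-stable (reaches? G U x) λ ¬r → none (x , Ix , ¬r)

-- Colouring the two sides and merging the results.

module Merge {d n : ℕ} (G : Graph (Fin n)) (regular : Regular G d) (common : CommonUnique G) {U : Subset n} where
  open RegularGraph G regular

  -- The map `σ` selects which `r + 1` colours the side dominates: the lowest for `id`, the highest
  -- for `opposite`. Together they are all `d + 1` colours once `d ≤ r + suc r`.
  OnSide : Side G U → ℕ → (Colour → Colour) → Partial → Set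
  OnSide side r σ c = PartialProper c × (∀ {x k} → c x ≡ just k → Side.In side x) ×
    (∀ k → toℕ k ≤ r → ∃[ z ] c z ≡ just (σ k) × Rainbow c z)

  module ColourSide (side : Side G U) where
    open Side side

    module _ {v : Fin n} (Iv : In v) (avoids : ∀ {u} → Adj G v u → u Subset.∉ U)
      {r : ℕ} (r+|U|≤d : r + ∣ U ∣ ≤ d) (2r≤d : 2 * r ≤ d) (σ : Colour → Colour) (σ-inj : Inj σ) where

      bad good ws : List (Fin n)
      bad  = filter (reaches? G U) (nbrs G v)
      good = filter (¬? ∘ reaches? G U) (nbrs G v)
      ws   = take r good

      bad≤ : length bad ≤ ∣ U ∣
      bad≤ = length≤card (λ y u → Adj G v y × Adj G y u × u Subset.∈ U)
        (λ { (vy , yu , u∈U) (vy′ , y′u , _) → common (λ { refl → out Iv u∈U }) vy (symm G yu) vy′ (symm G y′u) })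
        (filter⁺ (reaches? G U) (nbrs! G v)) U hit
        where
        hit : ∀ {y} → y ∈ bad → ∃[ u ] u Subset.∈ U × Adj G v y × Adj G y u × u Subset.∈ U
        hit y∈ with ∈-filter⁻ (reaches? G U) {xs = nbrs G v} y∈
        ... | y∈nbrs , u , u∈U , yu = u , u∈U , ∈nbrs⁻ G y∈nbrs , yu , u∈U

      r≤good : r ≤ length good
      r≤good = +-cancelʳ-≤ ∣ U ∣ r (length good) (begin
        r + ∣ U ∣                ≤⟨ r+|U|≤d ⟩
        d                        ≡⟨ trans (length-filter-¬ (reaches? G U) (nbrs G v)) (regular v) ⟨
        length bad + length good ≤⟨ +-monoˡ-≤ (length good) bad≤ ⟩
        ∣ U ∣ + length good      ≡⟨ +-comm ∣ U ∣ (length good) ⟩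
        length good + ∣ U ∣      ∎)
        where open ≤-Reasoning

      |ws|≡r : length ws ≡ r
      |ws|≡r = trans (length-take r good) (m≤n⇒m⊓n≡m r≤good)

      ws! : Unique ws
      ws! = take⁺ r (filter⁺ (¬? ∘ reaches? G U) (nbrs! G v))

      ws⁻ : All (λ w → Adj G v w × ¬ Reaches G U w) ws
      ws⁻ = All.take⁺ r (All.tabulate λ w∈ →
        let w∈nbrs , ¬reaches = ∈-filter⁻ (¬? ∘ reaches? G U) {xs = nbrs G v} w∈ in ∈nbrs⁻ G w∈nbrs , ¬reaches)

      vws : All (Adj G v) ws
      vws = All.map proj₁ ws⁻

      v∷ws! : Unique (v ∷ ws)
      v∷ws! = All.map (adj⇒≢ G) vws ∷ ws!

      |ws|≤d : suc (length ws) ≤ suc d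
      |ws|≤d = s≤s (≤-trans (≤-reflexive |ws|≡r) (≤-trans (m≤m+n r _) 2r≤d))

      colour : Fin (suc (length ws)) → Colour
      colour i = σ (inject≤ i |ws|≤d)

      Prescribed : Fin (suc d) → Colour → Set
      Prescribed p k = ∃[ i ] lookup (v ∷ ws) i ≡ closed v p × colour i ≡ k

      prescribed? : ∀ p → Dec (∃ (Prescribed p))
      prescribed? p with any? (λ i → lookup (v ∷ ws) i ≟ closed v p)
      ... | yes (i , eq) = yes (colour i , i , eq , refl)
      ... | no  none     = no λ { (_ , i , eq , _) → none (i , eq) }

      Prescribed-fun : ∀ {p k k′} → Prescribed p k → Prescribed p k′ → k ≡ k′
      Prescribed-fun (i , eq , refl) (j , eq′ , refl) = cong colour (lookup-inj v∷ws! (trans eq (sym eq′)))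

      Prescribed-inj : ∀ {p p′ k} → Prescribed p k → Prescribed p′ k → p ≡ p′
      Prescribed-inj (i , eq , refl) (j , eq′ , same) with Fin.inject≤-injective |ws|≤d |ws|≤d i j (σ-inj (sym same))
      ... | refl = closed-inj v (trans (sym eq) eq′)

      colourSide : ∃ (OnSide side r σ)
      colourSide with Completion.complete Prescribed prescribed? Prescribed-fun Prescribed-inj
      ... | h₀ , h₀-inj , h₀-Prescribed = c , proper , (λ cx → near⇒In (support cx)) , dominators
        where
        open Around G regular common
        open ColouringAround (colourAround v h₀ h₀-inj ws! vws (≤-trans (≤-reflexive (cong (2 *_) |ws|≡r)) 2r≤d))
          renaming (colouring to c)

        adj⇒In : ∀ {x y} → In x → Adj G x y → y Subset.∉ U → In y
        adj⇒In Ix xy y∉U with border Ix xy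
        ... | inj₁ Iy  = Iy
        ... | inj₂ y∈U = contradiction y∈U y∉U

        selected : ∀ {z} → z ∈ v ∷ ws → In z × (∀ {u} → Adj G z u → u Subset.∉ U)
        selected (here refl) = Iv , avoids
        selected (there w∈)  with All.lookup ws⁻ w∈
        ... | vw , ¬reaches = adj⇒In Iv vw (avoids vw) , λ wu u∈U → ¬reaches (_ , u∈U , wu)

        near⇒In : ∀ {x} → ∃[ z ] z ∈ v ∷ ws × Near z x → In x
        near⇒In (z , z∈ , zx) with selected z∈ | near⇒≡⊎adj zx
        ... | Iz , _        | inj₁ refl = Iz
        ... | Iz , z-avoids | inj₂ zx   = adj⇒In Iz zx (z-avoids zx)

        near-centre : ∀ i → Near v (lookup (v ∷ ws) i)
        near-centre zero    = near-refl
        near-centre (suc i) = adj⇒near (All.lookup vws (∈-lookup i))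

        at : ∀ i → c (lookup (v ∷ ws) i) ≡ just (colour i)
        at i with near-centre i
        ... | p , vp≡ = trans (cong c (sym vp≡)) (trans (centre p) (cong just (h₀-Prescribed (i , sym vp≡ , refl))))

        rainbow-at : ∀ i → Rainbow c (lookup (v ∷ ws) i)
        rainbow-at zero    = h₀ , h₀-inj , centre
        rainbow-at (suc i) = rainbow (∈-lookup i)

        dominators : ∀ k → toℕ k ≤ r → ∃[ z ] c z ≡ just (σ k) × Rainbow c z
        dominators k k≤r = lookup (v ∷ ws) i , trans (at i) (cong (just ∘ σ) (Fin.toℕ-injective i≡k)) , rainbow-at i
          where
          i = fromℕ< (s≤s (≤-trans k≤r (≤-reflexive (sym |ws|≡r))))
          i≡k : toℕ (inject≤ i |ws|≤d) ≡ toℕ k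
          i≡k = trans (Fin.toℕ-inject≤ i |ws|≤d) (Fin.toℕ-fromℕ< _)

  -- By `border` an edge leaving a side ends in `U`, so no edge joins the disjoint sides and the two
  -- colourings neither overlap nor conflict.
  merge : ∀ (A B : Side G U) → (∀ {x} → Side.In A x → ¬ Side.In B x) → ∀ {r} → d ≤ r + suc r →
    ∃ (OnSide A r id) → ∃ (OnSide B r opposite) → HasBColoring G (suc d)
  merge A B disjoint {r} d≤ (a , a-proper , a-in , a-dom) (b , b-proper , b-in , b-dom) =
    Extend.hasBColoring G regular c c-proper dominators
    where
    c : Partial
    c x = a x <∣> b x

    c-inv : ∀ {x k} → c x ≡ just k → a x ≡ just k ⊎ b x ≡ just k
    c-inv {x} cx with a x
    ... | just _  = inj₁ cx
    ... | nothing = inj₂ cx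

    a⊑c : a ⊑ c
    a⊑c {x} ax rewrite ax = refl

    b⊑c : b ⊑ c
    b⊑c {x} bx with a x in ax
    ... | just _  = contradiction (b-in bx) (disjoint (a-in ax))
    ... | nothing = bx

    apart : ∀ {x y} → Side.In A x → Side.In B y → ¬ Adj G x y
    apart Ax By xy with Side.border A Ax xy
    ... | inj₁ Ay  = disjoint Ay By
    ... | inj₂ y∈U = Side.out B By y∈U

    c-proper : PartialProper c
    c-proper xy cx cy with c-inv cx | c-inv cy
    ... | inj₁ ax | inj₁ ay = a-proper xy ax ay
    ... | inj₂ bx | inj₂ by = b-proper xy bx by
    ... | inj₁ ax | inj₂ by = apart (a-in ax) (b-in by) xy
    ... | inj₂ bx | inj₁ ay = apart (a-in ay) (b-in bx) (symm G xy)

    dominators : ∀ k → ∃[ z ] c z ≡ just k × Rainbow c z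
    dominators k with toℕ k ≤? r
    ... | yes k≤r = let z , az , rainbow = a-dom k k≤r in z , a⊑c az , rainbow-⊑ {a} {c} a⊑c rainbow
    ... | no  k≰r = let z , bz , rainbow = b-dom (opposite k) op≤r in
      z , b⊑c (trans bz (cong just (Fin.opposite-involutive k))) , rainbow-⊑ {b} {c} b⊑c rainbow
      where
      op≤r : toℕ (opposite k) ≤ r
      op≤r = ≤-trans (≤-reflexive (Fin.opposite-prop k)) (m≤n+o⇒m∸n≤o d (toℕ k)
        (≤-trans d≤ (≤-trans (≤-reflexive (+-comm r (suc r))) (+-monoˡ-≤ r (≰⇒> k≰r)))))

-- Halving the degree, and obtaining sides from a disconnection.

halve : ∀ d → ∃[ r ] 2 * r ≤ d × d ≤ r + suc r
halve 0 = 0 , z≤n , z≤n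
halve 1 = 0 , z≤n , s≤s z≤n
halve (suc (suc d)) with halve d
... | r , 2r≤d , d≤ = suc r , ≤-trans (≤-reflexive (*-suc 2 r)) (s≤s (s≤s 2r≤d)) ,
  s≤s (≤-trans (s≤s d≤) (≤-reflexive (sym (+-suc r (suc r)))))

-- Double negation shift, valid constructively over a finite index set.
¬¬-∀ : ∀ {n} {P : Fin n → Set} → (∀ i → ¬ ¬ P i) → ¬ ¬ (∀ i → P i)
¬¬-∀ {zero}  ¬¬P ¬∀P = ¬∀P λ ()
¬¬-∀ {suc n} ¬¬P ¬∀P = ¬¬P zero λ P₀ → ¬¬-∀ (¬¬P ∘ suc) λ Pₛ → ¬∀P λ { zero → P₀ ; (suc i) → Pₛ i }

module _ {n : ℕ} (G : Graph (Fin n)) (U : Subset n) where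

  -- The conditions of a `Side` for a subset, with quantifiers over `Fin n` only, which makes its
  -- existence decidable.
  Splits : Subset n → Set
  Splits A = (∃[ x ] x Subset.∈ A) × (∃[ y ] y Subset.∉ A × y Subset.∉ U) ×
    (∀ x → x Subset.∈ A → x Subset.∉ U × (∀ y → Adj G x y → y Subset.∈ A ⊎ y Subset.∈ U))

  splits? : ∀ A → Dec (Splits A)
  splits? A = any? (_∈? A) ×-dec any? (λ y → ¬? (y ∈? A) ×-dec ¬? (y ∈? U)) ×-dec
    all? λ x → (x ∈? A) →-dec (¬? (x ∈? U) ×-dec all? λ y → adj? G x y →-dec ((y ∈? A) ⊎-dec (y ∈? U)))

  Reachable : Fin n → Fin n → Set
  Reachable x y = ∃[ x∉ ] ∃[ y∉ ] Star (Adj (G ∖ U)) (x , x∉) (y , y∉)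

  component : (∀ x y → Dec (Reachable x y)) → ∀ x y (x∉ : x Subset.∉ U) (y∉ : y Subset.∉ U) →
    ¬ Reachable x y → ∃ Splits
  component reachable? x y x∉ y∉ ¬xy = A , (x , A⁺ (x∉ , x∉ , ε)) , (y , ¬xy ∘ A⁻ , y∉) , λ z z∈ → stays (A⁻ z∈)
    where
    A = tabulate (does ∘ reachable? x)

    A⁺ : ∀ {z} → Reachable x z → z Subset.∈ A
    A⁺ {z} xz = lookup⇒[]= z A (trans (lookup∘tabulate _ z) (dec-true (reachable? x z) xz))

    A⁻ : ∀ {z} → z Subset.∈ A → Reachable x z
    A⁻ {z} z∈ with reachable? x z | trans (sym (lookup∘tabulate (does ∘ reachable? x) z)) ([]=⇒lookup z∈)
    ... | yes xz | _ = xz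

    stays : ∀ {z} → Reachable x z → z Subset.∉ U × (∀ w → Adj G z w → w Subset.∈ A ⊎ w Subset.∈ U)
    stays (x∉ , z∉ , path) = z∉ , λ w zw → escape w zw
      where
      escape : ∀ w → Adj G _ w → w Subset.∈ A ⊎ w Subset.∈ U
      escape w zw with w ∈? U
      ... | yes w∈ = inj₂ w∈
      ... | no  w∉ = inj₁ (A⁺ (x∉ , w∉ , path ◅◅ (zw ◅ ε)))

  -- Deciding reachability is assumed under a double negation, harmless as the existence of a splitting is decidable.
  disconnected⇒splits : Disconnected (G ∖ U) → ∃ Splits
  disconnected⇒splits disconnected = decidable-stable (anySubset? splits?) λ unsplit →
    ¬¬-∀ (λ x → ¬¬-∀ λ y → ¬¬-excluded-middle) λ reachable? → disconnected (connected unsplit reachable?)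
    where
    connected : ¬ ∃ Splits → (∀ x y → Dec (Reachable x y)) → Connected (G ∖ U)
    connected unsplit reachable? (x , x∉) (y , y∉) with reachable? x y
    ... | yes (_ , _ , path) = path
    ... | no  ¬xy            = contradiction (component reachable? x y x∉ y∉ ¬xy) unsplit

  module _ {A : Subset n} (splits : Splits A) where

    near-side : Side G U
    near-side = record
      { In    = Subset._∈ A
      ; in?   = _∈? A
      ; out   = λ x∈ → proj₁ (proj₂ (proj₂ splits) _ x∈)
      ; border = λ x∈ xy → proj₂ (proj₂ (proj₂ splits) _ x∈) _ xy
      ; point = proj₁ splits
      ; other = proj₁ (proj₂ splits)
      }

    far-side : Side G U
    far-side = record
      { In    = λ x → x Subset.∉ A × x Subset.∉ U
      ; in?   = λ x → ¬? (x ∈? A) ×-dec ¬? (x ∈? U)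
      ; out   = proj₂
      ; border = border
      ; point = proj₁ (proj₂ splits)
      ; other = let x , x∈ = proj₁ splits in x , (λ (x∉ , _) → x∉ x∈) , proj₁ (proj₂ (proj₂ splits) x x∈)
      }
      where
      border : ∀ {x y} → x Subset.∉ A × x Subset.∉ U → Adj G x y → (y Subset.∉ A × y Subset.∉ U) ⊎ y Subset.∈ U
      border {x} {y} (x∉A , x∉U) xy with y ∈? U | y ∈? A
      ... | yes y∈U | _       = inj₂ y∈U
      ... | no  y∉U | no  y∉A = inj₁ (y∉A , y∉U)
      -- Reversed, such an edge would leave `A` for a vertex outside both `A` and `U`.
      ... | no  _   | yes y∈A with proj₂ (proj₂ (proj₂ splits) y y∈A) x (symm G xy)
      ...   | inj₁ x∈A = contradiction x∈A x∉A
      ...   | inj₂ x∈U = contradiction x∈U x∉U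

-- A predicate closed under adjacency that holds at `x` and fails at `y` would make the empty set
-- separating, so `k` would be 0.
minimal⇒connected : ∀ {n} (G : Graph (Fin n)) {k} → (∀ U → Separating G U → k ≤ ∣ U ∣) → 1 ≤ k →
  (P : Fin n → Set) → (∀ {x y} → P x → Adj G x y → P y) → ∀ {x} → P x → ∀ y → ¬ ¬ P y
minimal⇒connected {n} G minimal 1≤k P P-closed {x} Px y ¬Py =
  1+n≰n (≤-trans 1≤k (≤-trans (minimal Subset.⊥ (inj₁ disconnected)) (≤-reflexive (∣⊥∣≡0 n))))
  where
  walk : ∀ {u w} → Star (Adj (G ∖ Subset.⊥)) u w → P (proj₁ u) → P (proj₁ w)
  walk ε           Pu = Pu
  walk (uv ◅ path) Pu = walk path (P-closed Pu uv)

  disconnected : Disconnected (G ∖ Subset.⊥)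
  disconnected connected = ¬Py (walk (connected (x , ∉⊥) (y , ∉⊥)) Px)

-- The b-chromatic number of a regular graph.

module BChromatic {d n : ℕ} (G : Graph (Fin n)) (regular : Regular G d) where
  open RegularGraph G regular

  -- A dominating vertex shows all colours but its own on its `d` neighbours.
  bColouring≤ : ∀ m → HasBColoring G m → m ≤ suc d
  bColouring≤ zero    _ = z≤n
  bColouring≤ (suc m) (c , proper , dominating) with dominating zero
  ... | z , cz , sees = s≤s (injective⇒≤ {f = position} position-inj)
    where
    seen : ∀ j → ∃[ u ] Adj G z u × c u ≡ suc j
    seen j = sees (suc j) λ ()

    position : Fin m → Fin d
    position j = proj₁ (closed-surj (proj₁ (proj₂ (seen j))))

    position-inj : Inj position
    position-inj {i} {j} eq = Fin.suc-injective (begin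
      suc i                           ≡⟨ colour-at i ⟨
      c (closed z (suc (position i))) ≡⟨ cong (c ∘ closed z ∘ suc) eq ⟩
      c (closed z (suc (position j))) ≡⟨ colour-at j ⟩
      suc j                           ∎)
      where
      open ≡-Reasoning
      colour-at : ∀ j → c (closed z (suc (position j))) ≡ suc j
      colour-at j = trans (cong c (proj₂ (closed-surj (proj₁ (proj₂ (seen j)))))) (proj₂ (proj₂ (seen j)))

  -- For `d ≤ 1` the closed neighbourhood N[v] is complete, so colouring it injectively makes each
  -- of its vertices dominating.
  hasBColouring-d≤1 : Fin n → d ≤ 1 → HasBColoring G (suc d)
  hasBColouring-d≤1 v d≤1 with Extend.extend G regular (paint v id (const nothing)) (paint-proper (λ ()) id (λ _ ()) λ _ _ _ ())
  ... | C , C-proper , C-extends = C , C-proper , λ i → closed v i , C-extends (paint-closed i) , λ j j≢i →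
    closed v j , adjacent i j d≤1 (j≢i ∘ sym) , C-extends (paint-closed j)
    where
    adjacent : ∀ i j → d ≤ 1 → i ≢ j → Adj G (closed v i) (closed v j)
    adjacent zero    zero    _   i≢j = contradiction refl i≢j
    adjacent zero    (suc j) _   _   = subst (λ x → Adj G x (closed v (suc j))) (sym (closed-zero v)) (closed-adj v j)
    adjacent (suc i) zero    _   _   = subst (Adj G (closed v (suc i))) (sym (closed-zero v)) (symm G (closed-adj v i))
    adjacent (suc i) (suc j) d≤1 i≢j = contradiction (cong suc (only d≤1 i j)) i≢j
      where
      only : ∀ {d} → d ≤ 1 → (i j : Fin d) → i ≡ j
      only (s≤s z≤n) zero zero = refl

  module _ (common : CommonUnique G) where

    oneVertex⇒d≤ : ∀ {U} → OneVertex (G ∖ U) → d ≤ ∣ U ∣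
    oneVertex⇒d≤ {U} ((v , v∉U) , only) = subst (_≤ ∣ U ∣) (regular v) (⊆⇒length≤card (nbrs! G v) U nbrs⊆U)
      where
      nbrs⊆U : ∀ {x} → x ∈ nbrs G v → x Subset.∈ U
      nbrs⊆U {x} x∈ = decidable-stable (x ∈? U) λ x∉U → adj⇒≢ G (∈nbrs⁻ G x∈) (sym (cong proj₁ (only (x , x∉U))))

    hasBColouring-split : 2 ≤ d → ∀ {U} → 2 * ∣ U ∣ ≤ suc d → (∀ W → Separating G W → ∣ U ∣ ≤ ∣ W ∣) →
      Disconnected (G ∖ U) → HasBColoring G (suc d)
    hasBColouring-split 2≤d {U} small minimal disconnected with disconnected⇒splits G U disconnected | halve d
    ... | S , splits | r , 2r≤d , d≤2r+1 =
      Merge.merge G regular common A B (λ x∈ (x∉ , _) → x∉ x∈) d≤2r+1 (onSide A id id) (onSide B opposite opposite-inj)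
      where
      A = near-side G U splits
      B = far-side G U splits

      opposite-inj : Inj (opposite {suc d})
      opposite-inj {i} {j} eq =
        trans (sym (Fin.opposite-involutive i)) (trans (cong opposite eq) (Fin.opposite-involutive j))

      r+|U|≤d : r + ∣ U ∣ ≤ d
      r+|U|≤d = ℕ.s≤s⁻¹ (*-cancelˡ-< 2 (r + ∣ U ∣) (suc d) (begin-strict
        2 * (r + ∣ U ∣)     ≡⟨ *-distribˡ-+ 2 r ∣ U ∣ ⟩
        2 * r + 2 * ∣ U ∣   ≤⟨ +-mono-≤ 2r≤d small ⟩
        d + suc d           <⟨ ≤-refl ⟩
        suc d + suc d       ≡⟨ cong (suc d +_) (+-identityʳ (suc d)) ⟨
        2 * suc d           ∎))
        where open ≤-Reasoning

      onSide : (side : Side G U) (σ : Colour → Colour) → Inj σ → ∃ (Merge.OnSide G regular common side r σ)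
      onSide side σ σ-inj with GoodVertex.goodVertex G regular common 2≤d small (minimal⇒connected G minimal) side
      ... | v , Iv , avoids = Merge.ColourSide.colourSide G regular common side Iv avoids r+|U|≤d 2r≤d σ σ-inj

    hasBColouring : Fin n → ∀ {k} → IsVertexConnectivity G k → 2 * k ≤ suc d → HasBColoring G (suc d)
    hasBColouring v ((U , separating , refl) , minimal) small with 2 ≤? d | separating
    ... | no  2≰d | _                   = hasBColouring-d≤1 v (ℕ.s≤s⁻¹ (≰⇒> 2≰d))
    ... | yes 2≤d | inj₁ disconnected   = hasBColouring-split 2≤d small minimal disconnected
    -- All `d` neighbours of the remaining vertex lie in `U`, so `2 * d ≤ d + 1`: this case belongs
    -- to `d ≤ 1`.
    ... | yes 2≤d | inj₂ oneVertex      = hasBColouring-d≤1 v (+-cancelˡ-≤ d d 1 (begin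
      d + d       ≡⟨ cong (d +_) (+-identityʳ d) ⟨
      2 * d       ≤⟨ *-monoʳ-≤ 2 (oneVertex⇒d≤ oneVertex) ⟩
      2 * ∣ U ∣   ≤⟨ small ⟩
      suc d       ≡⟨ +-comm 1 d ⟩
      d + 1       ∎))
      where
      open ≤-Reasoning

-- The Petersen graph.

_≢?_ : ∀ {n} (x y : Fin n) → Dec (x ≢ y)
x ≢? y = ¬? (x ≟ y)

module Petersen where

  P : Fin 10 → Fin 10 → Set
  P = Adj petersen

  P? : ∀ x y → Dec (P x y)
  P? = adj? petersen

  -- Adjacency lists, so that finite checks can range over three neighbours instead of ten vertices.
  neighbours : Fin 10 → Vec (Fin 10) 3
  neighbours 0F = 1F ∷ 4F ∷ 5F ∷ []
  neighbours 1F = 0F ∷ 2F ∷ 6F ∷ []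
  neighbours 2F = 1F ∷ 3F ∷ 7F ∷ []
  neighbours 3F = 2F ∷ 4F ∷ 8F ∷ []
  neighbours 4F = 3F ∷ 0F ∷ 9F ∷ []
  neighbours 5F = 0F ∷ 7F ∷ 8F ∷ []
  neighbours 6F = 1F ∷ 9F ∷ 8F ∷ []
  neighbours 7F = 2F ∷ 5F ∷ 9F ∷ []
  neighbours 8F = 3F ∷ 6F ∷ 5F ∷ []
  neighbours 9F = 4F ∷ 7F ∷ 6F ∷ []

  nb : Fin 10 → Fin 3 → Fin 10
  nb v = Vec.lookup (neighbours v)

  opaque

    nb-adj : ∀ v i → P v (nb v i)
    nb-adj = from-yes (all? λ v → all? λ i → P? v (nb v i))

    nb-surj : ∀ v u → P v u → ∃[ i ] nb v i ≡ u
    nb-surj = from-yes (all? λ v → all? λ u → P? v u →-dec any? λ i → nb v i ≟ u)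

  P₁ : Fin 10 → Fin 10 → Set
  P₁ u v = ∃[ i ] nb u i ≡ v

  P₁? : ∀ u v → Dec (P₁ u v)
  P₁? u v = any? λ i → nb u i ≟ v

  P₁⇒P : ∀ {u v} → P₁ u v → P u v
  P₁⇒P (i , refl) = nb-adj _ i

  -- A walk of length three whose two inner vertices avoid `m` and `x`.
  Detour : (u v m x : Fin 10) → Set
  Detour u v m x = ∃[ i ] nb u i ≢ m × nb u i ≢ x × ∃[ j ] nb (nb u i) j ≢ m × nb (nb u i) j ≢ x × P₁ (nb (nb u i) j) v

  detour? : ∀ u v m x → Dec (Detour u v m x)
  detour? u v m x = any? λ i → nb u i ≢? m ×-dec nb u i ≢? x ×-dec any? λ j →
    nb (nb u i) j ≢? m ×-dec nb (nb u i) j ≢? x ×-dec P₁? (nb (nb u i) j) v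

  -- Two vertices at distance 2 lie on three paths, one of length 2 and two disjoint ones of length 3.
  Routes : Fin 10 → Fin 10 → Set
  Routes u v = u ≡ v ⊎ P₁ u v ⊎ ∃[ i ] P₁ (nb u i) v × (∀ x → x ≢ u → x ≢ v → Detour u v (nb u i) x)

  opaque

    routes : ∀ u v → Routes u v
    routes = from-yes (all? λ u → all? λ v → (u ≟ v) ⊎-dec P₁? u v ⊎-dec any? λ i → P₁? (nb u i) v ×-dec
      all? λ x → x ≢? u →-dec x ≢? v →-dec detour? u v (nb u i) x)

  module _ {U : Subset 10} (small : ¬ (3 ≤ ∣ U ∣)) where

    cover : ∀ {m} → m Subset.∈ U → ∃[ x ] x Subset.∈ U × (∀ {y} → y ≢ m → y ≢ x → y Subset.∉ U)
    cover {m} m∈ with any? (λ x → (x ∈? U) ×-dec x ≢? m)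
    -- If `m` is all of `U`, it also plays the second deleted vertex.
    ... | no none             = m , m∈ , λ y≢m _ y∈ → none (_ , y∈ , y≢m)
    ... | yes (x , x∈ , x≢m) = x , x∈ , λ y≢m y≢x y∈ → small (⊆⇒length≤card ((y≢m ∷ y≢x ∷ []) ∷ pair! (x≢m ∘ sym)) U
      λ { (here refl) → y∈ ; (there (here refl)) → m∈ ; (there (there (here refl))) → x∈ })

    -- If the midpoint of the short route is deleted, at most one other vertex is, and a detour
    -- avoids both.
    connected : Connected (petersen ∖ U)
    connected (u , u∉) (v , v∉) with routes u v
    ... | inj₁ refl      = ε
    ... | inj₂ (inj₁ uv) = P₁⇒P uv ◅ ε
    ... | inj₂ (inj₂ (i , mv , detours)) with nb u i ∈? U
    ...   | no  m∉ = _◅_ {j = nb u i , m∉} (nb-adj u i) (P₁⇒P mv ◅ ε)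
    ...   | yes m∈ with cover m∈
    ...     | x , x∈ , rest with detours x (λ { refl → u∉ x∈ }) (λ { refl → v∉ x∈ })
    ...       | i , a≢m , a≢x , j , b≢m , b≢x , bv =
      _◅_ {j = nb u i , rest a≢m a≢x} (nb-adj u i) (_◅_ {j = nb (nb u i) j , rest b≢m b≢x} (nb-adj (nb u i) j) (P₁⇒P bv ◅ ε))

  regular : Regular petersen 3
  regular = from-yes (all? λ v → degree petersen v ℕ.≟ 3)

  connectivity≥3 : ∀ U → Separating petersen U → 3 ≤ ∣ U ∣
  connectivity≥3 U separating with 3 ≤? ∣ U ∣ | separating
  ... | yes 3≤   | _                 = 3≤
  ... | no  small | inj₁ disconnected = contradiction (connected small) disconnected
  ... | no  small | inj₂ ((v , v∉) , only) =
    contradiction (subst (_≤ ∣ U ∣) (regular v) (⊆⇒length≤card (nbrs! petersen v) U nbrs⊆U)) small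
    where
    nbrs⊆U : ∀ {x} → x ∈ nbrs petersen v → x Subset.∈ U
    nbrs⊆U {x} x∈ = decidable-stable (x ∈? U) λ x∉ → adj⇒≢ petersen (∈nbrs⁻ petersen x∈) (sym (cong proj₁ (only (x , x∉))))

  -- The neighbourhood of `0F`, whose removal isolates that vertex.
  N₀ : Subset 10
  N₀ = outside ∷ inside ∷ outside ∷ outside ∷ inside ∷ inside ∷ outside ∷ outside ∷ outside ∷ outside ∷ []

  separated : Disconnected (petersen ∖ N₀)
  separated connected = stuck (connected (0F , from-no (0F ∈? N₀)) (2F , from-no (2F ∈? N₀)))
    where
    enclosed : ∀ y → P 0F y → y Subset.∈ N₀
    enclosed = from-yes (all? λ y → P? 0F y →-dec (y ∈? N₀))

    stuck : ∀ {p q} → ¬ Star (Adj (petersen ∖ N₀)) (0F , p) (2F , q)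
    stuck (_◅_ {j = y , y∉} 0y _) = y∉ (enclosed y 0y)

  connectivity : IsVertexConnectivity petersen 3
  connectivity = (N₀ , inj₁ separated , refl) , connectivity≥3

  noC₄ : ¬ Contains petersen C₄
  noC₄ (f , f-inj , edge) = contradiction (f-inj {1F} {3F}
    (c4 (f 0F) (f 1F) (edge (inj₁ (here refl))) (f 2F) (edge (inj₁ (there (here refl)))) 
      (λ eq → contradiction (f-inj eq) λ ())
      (f 3F) (edge (inj₁ (there (there (here refl))))) (edge (inj₁ (there (there (there (here refl)))))))) λ ()
    where
    c4 : ∀ a b → P a b → ∀ c → P b c → a ≢ c → ∀ d → P c d → P d a → b ≡ d
    c4 = from-yes (all? λ a → all? λ b → P? a b →-dec all? λ c → P? b c →-dec a ≢? c →-dec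
      all? λ d → P? c d →-dec P? d a →-dec (b ≟ d))

  Dominated : (Fin 10 → Fin 4) → Fin 4 → Set
  Dominated c i = ∃[ v ] c v ≡ i × (∀ j → j ≢ i → ∃[ m ] c (nb v m) ≡ j)

  dominated? : ∀ c i → Dec (Dominated c i)
  dominated? c i = any? λ v → (c v ≟ i) ×-dec all? λ j → j ≢? i →-dec any? λ m → c (nb v m) ≟ j

  opaque

    -- Exhaustive search. Each edge constraint appears as soon as both ends have colours, which
    -- prunes the enumeration; the edge 0 - 1 is covered by the two fixed colours.
    search : ∀ c₀ → c₀ ≡ 0F → ∀ c₁ → c₁ ≡ 1F → ∀ c₂ → c₁ ≢ c₂ → ∀ c₃ → c₂ ≢ c₃ → ∀ c₄ → c₃ ≢ c₄ → c₄ ≢ c₀ →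
      ∀ c₅ → c₀ ≢ c₅ → ∀ c₆ → c₁ ≢ c₆ → ∀ c₇ → c₂ ≢ c₇ → c₅ ≢ c₇ →
      ∀ c₈ → c₃ ≢ c₈ → c₆ ≢ c₈ → c₈ ≢ c₅ → ∀ c₉ → c₄ ≢ c₉ → c₇ ≢ c₉ → c₉ ≢ c₆ →
      ¬ (∀ i → Dominated (Vec.lookup (c₀ ∷ c₁ ∷ c₂ ∷ c₃ ∷ c₄ ∷ c₅ ∷ c₆ ∷ c₇ ∷ c₈ ∷ c₉ ∷ [])) i)
    search = from-yes (
      all? λ c₀ → c₀ ≟ 0F →-dec all? λ c₁ → c₁ ≟ 1F →-dec all? λ c₂ → c₁ ≢? c₂ →-dec all? λ c₃ → c₂ ≢? c₃ →-dec
      all? λ c₄ → c₃ ≢? c₄ →-dec c₄ ≢? c₀ →-dec all? λ c₅ → c₀ ≢? c₅ →-dec all? λ c₆ → c₁ ≢? c₆ →-dec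
      all? λ c₇ → c₂ ≢? c₇ →-dec c₅ ≢? c₇ →-dec all? λ c₈ → c₃ ≢? c₈ →-dec c₆ ≢? c₈ →-dec c₈ ≢? c₅ →-dec
      all? λ c₉ → c₄ ≢? c₉ →-dec c₇ ≢? c₉ →-dec c₉ ≢? c₆ →-dec
      ¬? (all? λ i → dominated? (Vec.lookup (c₀ ∷ c₁ ∷ c₂ ∷ c₃ ∷ c₄ ∷ c₅ ∷ c₆ ∷ c₇ ∷ c₈ ∷ c₉ ∷ [])) i))

  module Normalise (c : Fin 10 → Fin 4) (proper : Proper petersen c) where

    -- A partial injection on colours, which `Completion` extends to the renaming permutation.
    Target : Fin 4 → Fin 4 → Set
    Target p k = p ≡ c 0F × k ≡ 0F ⊎ p ≡ c 1F × k ≡ 1F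

    c₀≢c₁ : c 0F ≢ c 1F
    c₀≢c₁ = proper (from-yes (P? 0F 1F))

    target? : ∀ p → Dec (∃ (Target p))
    target? p = any? λ k → ((p ≟ c 0F) ×-dec (k ≟ 0F)) ⊎-dec ((p ≟ c 1F) ×-dec (k ≟ 1F))

    Target-fun : ∀ {p k k′} → Target p k → Target p k′ → k ≡ k′
    Target-fun (inj₁ (_ , refl))    (inj₁ (_ , refl))    = refl
    Target-fun (inj₁ (refl , _))    (inj₂ (p≡ , _))      = contradiction p≡ c₀≢c₁
    Target-fun (inj₂ (refl , _))    (inj₁ (p≡ , _))      = contradiction (sym p≡) c₀≢c₁
    Target-fun (inj₂ (_ , refl))    (inj₂ (_ , refl))    = refl

    Target-inj : ∀ {p p′ k} → Target p k → Target p′ k → p ≡ p′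
    Target-inj (inj₁ (p≡ , refl)) (inj₁ (p′≡ , _)) = trans p≡ (sym p′≡)
    Target-inj (inj₂ (p≡ , refl)) (inj₂ (p′≡ , _)) = trans p≡ (sym p′≡)

    opaque

      normalise : ∃[ h ] Inj {Fin 4} {Fin 4} h × h (c 0F) ≡ 0F × h (c 1F) ≡ 1F
      normalise = let h , h-inj , h-Target = Completion.complete Target target? Target-fun Target-inj in
        h , h-inj , h-Target (inj₁ (refl , refl)) , h-Target (inj₂ (refl , refl))

  -- Permuting colours, the ends of the edge 0—1 may be assumed to have colours 0 and 1, which shortens the search.
  noBColouring : ¬ HasBColoring petersen 4
  noBColouring (c , proper , dominating) with Normalise.normalise c proper
  ... | h , h-inj , e₀ , e₁ =
    search (e 0F) e₀ (e 1F) e₁ (e 2F) (edge 1F 2F) (e 3F) (edge 2F 3F)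
      (e 4F) (edge 3F 4F) (edge 4F 0F) (e 5F) (edge 0F 5F) (e 6F) (edge 1F 6F)
      (e 7F) (edge 2F 7F) (edge 5F 7F) (e 8F) (edge 3F 8F) (edge 6F 8F) (edge 8F 5F)
      (e 9F) (edge 4F 9F) (edge 7F 9F) (edge 9F 6F) dominated
    where
    e : Fin 10 → Fin 4
    e = h ∘ c

    edge : ∀ u v {_ : True (P? u v)} → e u ≢ e v
    edge u v {uv} = proper (toWitness uv) ∘ h-inj

    table : ∀ v → Vec.lookup (Vec.tabulate e) v ≡ e v
    table = lookup∘tabulate e

    dominated : ∀ i → Dominated (Vec.lookup (Vec.tabulate e)) i
    dominated i with inj⇒surj h-inj i
    ... | k , refl with dominating k
    ...   | z , refl , sees = z , table z , seen
      where
      seen : ∀ j → j ≢ h k → ∃[ m ] Vec.lookup (Vec.tabulate e) (nb z m) ≡ j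
      seen j j≢ with inj⇒surj h-inj j
      ... | l , refl with sees l (j≢ ∘ cong h)
      ...   | u , zu , refl with nb-surj z u zu
      ...     | m , refl = m , table (nb z m)

theorem5 : (∀ (d n : ℕ) .{{_ : NonZero n}} (G : Graph (Fin n)) →
    Regular G d → ¬ Contains G C₄ →
    ∀ κ → IsVertexConnectivity G κ → 2 * κ ≤ d + 1 →
    IsBChromaticNumber G (d + 1))
    × (Regular petersen 3
    × ¬ Contains petersen C₄
    × IsVertexConnectivity petersen ((3 + 1) / 2 + 1)
    × ¬ IsBChromaticNumber petersen (3 + 1))
-- The value `(3 + 1) / 2 + 1` computes to 3.
theorem5 = general , Petersen.regular , Petersen.noC₄ , Petersen.connectivity , λ (has , _) → Petersen.noBColouring has
  where
  general : ∀ (d n : ℕ) .{{_ : NonZero n}} (G : Graph (Fin n)) → Regular G d → ¬ Contains G C₄ →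
    ∀ κ → IsVertexConnectivity G κ → 2 * κ ≤ d + 1 → IsBChromaticNumber G (d + 1)
  -- Matching `n` as a successor supplies the vertex `zero`, around which the case `d ≤ 1` is
  -- coloured.
  general d n@(suc _) G regular noC₄ κ connectivity small rewrite +-comm d 1 =
    BChromatic.hasBColouring G regular (noC₄⇒commonUnique G noC₄) zero connectivity small , BChromatic.bColouring≤ G regular
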